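{- Let $w \in \mathfrak{S}_n$ and $k \in [1,n-1]$. Then $\max_k(w) > \min_k(w)$ if and only if there exist positions $i<p<j$ with $w(i)>w(p)>w(j)$ and $i \le k < j$ such that the sets $$L_w := \{w(q) : i < q \le k,\ w(q) > w(i)\} \quad\text{and}\quad R_w := \{w(q) : k < q < j,\ w(q) < w(j)\}$$ satisfy both of the following: \begin{itemize} \item $|L_w| = |R_w|$, and \item the elements of $L_w$ appear in increasing order from left to right in $w$, and the elements of $R_w$ appear in increasing order from left to right in $w$. \end{itemize}
   Context: $\mathfrak{S}_n$ is the symmetric group on $[1,n]$, written in one-line notation $w=w(1)\cdots w(n)$; $\sigma_i$ is the simple reflection exchanging $i$ and $i+1$. $\min_k(w)$ and $\max_k(w)$ are the minimum and maximum, over all reduced decompositions (minimal-length expressions as products of simple reflections) of $w$, of the number of occurrences of the factor $\sigma_k$. -}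

module Defs where

open import Data.Nat using (ℕ; zero; suc; _∸_; _≤_; _<_; _<?_; _≤?_; _≟_)
open import Data.Fin using (Fin; toℕ)
open import Data.Fin.Permutation using (Permutation′; _⟨$⟩ʳ_)
open import Data.List using (List; []; _∷_; length; filter)
open import Data.List.Relation.Unary.All using (All)
open import Data.Product using (_×_; Σ; ∃; _,_)
open import Relation.Nullary using (Dec; yes; no)
open import Relation.Nullary.Decidable using (_×-dec_)
open import Relation.Binary.PropositionalEquality using (_≡_)
open import Data.List using (allFin)

-- Conventions: permutations of [1,n] are represented by  Permutation′ n  (bijections of
-- Fin n); position q (1-based) corresponds to the Fin element with toℕ = q-1, and
-- value v (1-based) likewise to toℕ = v-1.  So the one-line notation w(q) is
-- 1 + toℕ (w ⟨$⟩ʳ (q-1)).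

val : ∀ {n} → Permutation′ n → Fin n → ℕ
val w q = toℕ (w ⟨$⟩ʳ q)

-- the simple reflection σ_a (a ∈ [1,n-1], 1-based) acting on 0-based values:
-- it exchanges the 1-based values a and a+1, i.e. 0-based a-1 and a.
σ : ℕ → ℕ → ℕ
σ a x with suc x ≟ a
... | yes _ = a
... | no _ with x ≟ a
...   | yes _ = a ∸ 1
...   | no _ = x

evalWord : List ℕ → ℕ → ℕ
evalWord [] x = x
evalWord (a ∷ as) x = σ a (evalWord as x)

ValidLetter : ℕ → ℕ → Set
ValidLetter n a = 1 ≤ a × a < n

Expresses : ∀ {n} → Permutation′ n → List ℕ → Set
Expresses {n} w as = All (ValidLetter n) as × (∀ (q : Fin n) → evalWord as (toℕ q) ≡ val w q)

Reduced : ∀ {n} → Permutation′ n → List ℕ → Set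
Reduced w as = Expresses w as × (∀ bs → Expresses w bs → length as ≤ length bs)

occ : ℕ → List ℕ → ℕ
occ k [] = 0
occ k (a ∷ as) with a ≟ k
... | yes _ = suc (occ k as)
... | no _ = occ k as

-- max_k(w) > min_k(w): two reduced decompositions with different numbers of σ_k
-- (the set of reduced decompositions is finite and nonempty, so this is literally
-- max > min).
MaxGtMin : ∀ {n} → Permutation′ n → ℕ → Set
MaxGtMin w k = ∃ λ u → ∃ λ v → Reduced w u × Reduced w v × occ k u < occ k v

-- Positions q (0-based) whose values form L_w, for 0-based i:
--   1-based condition  i < q ≤ k  and  w(q) > w(i).
InL : ∀ {n} → Permutation′ n → ℕ → Fin n → Fin n → Set
InL w k i q = toℕ i < toℕ q × toℕ q < k × val w i < val w q

InL? : ∀ {n} (w : Permutation′ n) k i q → Dec (InL w k i q)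
InL? w k i q = (toℕ i <? toℕ q) ×-dec ((toℕ q <? k) ×-dec (val w i <? val w q))

-- Positions q whose values form R_w, for 0-based j:
--   1-based condition  k < q < j  and  w(q) < w(j).
InR : ∀ {n} → Permutation′ n → ℕ → Fin n → Fin n → Set
InR w k j q = k ≤ toℕ q × toℕ q < toℕ j × val w q < val w j

InR? : ∀ {n} (w : Permutation′ n) k j q → Dec (InR w k j q)
InR? w k j q = (k ≤? toℕ q) ×-dec ((toℕ q <? toℕ j) ×-dec (val w q <? val w j))

-- |L_w| and |R_w| (w is injective, so counting positions = counting values)
cardL : ∀ {n} → Permutation′ n → ℕ → Fin n → ℕ
cardL {n} w k i = length (filter (InL? w k i) (allFin n))

cardR : ∀ {n} → Permutation′ n → ℕ → Fin n → ℕ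
cardR {n} w k j = length (filter (InR? w k j) (allFin n))

LIncreasing : ∀ {n} → Permutation′ n → ℕ → Fin n → Set
LIncreasing {n} w k i = ∀ (q r : Fin n) → InL w k i q → InL w k i r → toℕ q < toℕ r → val w q < val w r

RIncreasing : ∀ {n} → Permutation′ n → ℕ → Fin n → Set
RIncreasing {n} w k j = ∀ (q r : Fin n) → InR w k j q → InR w k j r → toℕ q < toℕ r → val w q < val w r

-- the right-hand side of the theorem.  With 0-based positions, the 1-based condition
-- i ≤ k < j reads  toℕ i < k ≤ toℕ j.
Witness : ∀ {n} → Permutation′ n → ℕ → Set
Witness {n} w k =
  Σ (Fin n) λ i → Σ (Fin n) λ p → Σ (Fin n) λ j →
    toℕ i < toℕ p × toℕ p < toℕ j ×
    val w p < val w i × val w j < val w p ×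
    toℕ i < k × k ≤ toℕ j ×
    cardL w k i ≡ cardR w k j ×
    LIncreasing w k i × RIncreasing w k j

{-# OPTIONS --safe #-}

-- Call a configuration as on the right-hand side of the theorem a pinch at k.  Writing words from
-- the right, a reduced word of w ending in σ_a is a reduced word of w σ_a followed by σ_a, where w
-- has a descent at a.  Two facts about pinches carry the proof, both by induction on length.
-- (1) If w has a descent at a and w σ_a has a pinch, then so does w.  Hence, following Matsumoto's
--     argument, if w has no pinch then all its reduced words contain σ_k equally often: a braid move
--     that changes this number occurs only when w decreases at three consecutive positions around k,
--     which is a pinch with L and R empty.
-- (2) If w has a pinch, then it decreases at three consecutive positions around k, or w σ_a has a
--     pinch for some descent a of w: any descent strictly between i and j on one side of the cut can
--     be undone, and if none is left then either i or j can be moved inwards or a decreasing pair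
--     (element of L, element of R) meets at the cut and is exchanged.
module Submission where

open import Defs
open import Data.Nat using (ℕ; zero; suc; _+_; _∸_; _≤_; _<_; z≤n; s≤s; z<s; s<s; s≤s⁻¹; _<?_; _≤?_; _≟_)
open import Data.Nat.Properties
open import Data.Fin.Permutation using (Permutation′)
open import Data.Product using (_×_; ∃; ∃₂; _,_; proj₁; proj₂)
open import Data.Sum as Sum using (_⊎_; map₁; map₂; inj₁; inj₂; [_,_]′)
open import Data.Maybe using (Maybe; just; nothing)
open import Data.Maybe.Relation.Unary.All as Maybe using (just; nothing)
open import Data.Bool using (Bool; true; false; if_then_else_)
open import Data.Fin as Fin using (Fin; toℕ; fromℕ<)
open import Data.Fin.Properties using (toℕ<n; toℕ-fromℕ<; fromℕ<-toℕ; toℕ-injective; fromℕ<-injective)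
open import Data.List using (List; []; _∷_; _∷ʳ_; length; filter; applyUpTo; tabulate; initLast; _∷ʳ′_)
open import Data.List.Relation.Unary.All as All using (All; []; _∷_)
import Data.List.Relation.Unary.All.Properties as All
open import Data.List.Properties using (filter-accept; filter-reject; filter-none; length-++)
open import Data.List.Relation.Binary.Permutation.Propositional as ↭ using (_↭_)
open import Data.List.Relation.Binary.Permutation.Propositional.Properties using (↭-length; filter-↭)
open import Data.List.Relation.Unary.Any as Any using (Any; here; there)
open import Data.List.Membership.Propositional using (_∈_; _∉_; lose; find)
open import Data.List.Membership.Propositional.Properties using (∈-applyUpTo⁻)
open import Data.List.Relation.Binary.Subset.Propositional using (_⊆_)
open import Data.List.Relation.Binary.Subset.Propositional.Properties using (∷⁺ʳ; ⊆-refl; Any-resp-⊆)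
open import Function using (_∘_; flip; id)
open import Function.Bundles using (_⇔_; mk⇔; module Injection)
open import Function.Properties.Inverse using (↔⇒↣)
open import Level using (0ℓ)
open import Relation.Binary using (Rel; IsStrictTotalOrder; tri<; tri≈; tri>)
open import Relation.Binary.Construct.Flip.EqAndOrd using (isStrictTotalOrder)
open import Relation.Binary.PropositionalEquality
open import Relation.Nullary.Decidable using (_×-dec_; does; does-⇔; dec-true; dec-false)
open import Relation.Unary using (Decidable)
import Relation.Binary as Binary
open import Relation.Nullary using (¬_; Dec; yes; no; contradiction)

-- Pinches, read outwards from the cut.

private variable
  lo lo′ : Maybe ℕ
  zs zs′ ls ls′ rs rs′ bs : List ℕ
  t t′ x y c : ℕ

-- One half of the one-line notation, read outwards from the cut between positions k and k+1:
-- the left half is ordered by >, the right half by <, so that L_w and R_w become the same notion.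
-- Climb _≺_ lo zs t bs c says that c occurs in zs, that the entries ≺ c before it are increasing
-- outwards and exceed lo, that there are t of them, and that bs lists the other entries before c.
data Climb (_≺_ : Rel ℕ 0ℓ) : Maybe ℕ → List ℕ → ℕ → List ℕ → ℕ → Set where
  stop  : Maybe.All (_≺ c) lo → Climb _≺_ lo (c ∷ zs) 0 [] c
  below : Maybe.All (_≺ x) lo → Climb _≺_ (just x) zs t bs c → Climb _≺_ lo (x ∷ zs) (suc t) bs c
  above : c ≺ x → Climb _≺_ lo zs t bs c → Climb _≺_ lo (x ∷ zs) t (x ∷ bs) c

-- In either half, read outwards with its own order, such an exchange turns an ascent of `w` into a
-- descent.
data Swap (_≺_ : Rel ℕ 0ℓ) : List ℕ → List ℕ → Set where
  here  : x ≺ y → Swap _≺_ (x ∷ y ∷ zs) (y ∷ x ∷ zs)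
  there : Swap _≺_ zs zs′ → Swap _≺_ (x ∷ zs) (x ∷ zs′)

-- Here `top` is `w(i)`, `bottom` is `w(j)` and the shared `height` is |L_w| = |R_w|. The value
-- `w(p)` is a side entry; these are already smaller than `top` on the left and larger than `bottom`
-- on the right, so `middle` states the other inequality.
record Pinch (_≺_ : Rel ℕ 0ℓ) (ls rs : List ℕ) : Set where
  constructor pinch
  field
    {height}        : ℕ
    {sidesˡ sidesʳ} : List ℕ
    {top bottom}    : ℕ
    climbˡ          : Climb (flip _≺_) nothing ls height sidesˡ top
    climbʳ          : Climb _≺_ nothing rs height sidesʳ bottom
    bottom≺top      : bottom ≺ top
    middle          : Any (bottom ≺_) sidesˡ ⊎ Any (_≺ top) sidesʳ

module Half {_≺_ : Rel ℕ 0ℓ} (isSTO : IsStrictTotalOrder _≡_ _≺_) where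
  open IsStrictTotalOrder isSTO using (compare; asym) renaming (trans to ≺-trans; irrefl to ≺-irrefl)

  climb-lo : Climb _≺_ lo zs t bs c → Maybe.All (_≺ c) lo
  climb-lo (stop l)    = l
  climb-lo (below l g) with climb-lo g
  ... | just x≺c = Maybe.map (λ l≺x → ≺-trans l≺x x≺c) l
  climb-lo (above _ g) = climb-lo g

  climb-just : Climb _≺_ (just x) zs t bs c → x ≺ c
  climb-just = Maybe.drop-just ∘ climb-lo

  weaken : (∀ {x} → Maybe.All (_≺ x) lo → Maybe.All (_≺ x) lo′) →
           Climb _≺_ lo zs t bs c → Climb _≺_ lo′ zs t bs c
  weaken w (stop l)    = stop (w l)
  weaken w (below l g) = below (w l) g
  weaken w (above p g) = above p (weaken w g)

  forget : Climb _≺_ lo zs t bs c → Climb _≺_ nothing zs t bs c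
  forget = weaken (λ _ → nothing)

  -- The entries `≺ c` form an increasing chain, so any of them can serve as the end instead; side
  -- entries passed on the way exceed `c` and hence also the new end.
  climb-drop : Climb _≺_ lo zs t bs c → t′ < t →
               ∃₂ λ bs′ c′ → Climb _≺_ lo zs t′ bs′ c′ × c′ ≺ c
  climb-drop {t′ = zero}   (below l g) _ = [] , _ , stop l , climb-just g
  climb-drop {t′ = suc t′} (below l g) (s<s t′<t) with climb-drop g t′<t
  ... | bs′ , c′ , g′ , c′≺c = bs′ , c′ , below l g′ , c′≺c
  climb-drop (above p g) t′<t with climb-drop g t′<t
  ... | bs′ , c′ , g′ , c′≺c = _ , c′ , above (≺-trans c′≺c p) g′ , c′≺c

  -- The climb survives unless both exchanged entries lie on its chain, the end `c` included. Then
  -- the climb stops at `x`, with `y` before it as a side entry. The last conjunct says that `y` is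
  -- at most `c`.
  climb-swap : Swap _≺_ zs zs′ → Climb _≺_ lo zs t bs c →
    (∃ λ bs′ → Climb _≺_ lo zs′ t bs′ c × bs ⊆ bs′) ⊎
    (∃₂ λ t′ bs′ → ∃₂ λ x y → t′ < t × Climb _≺_ lo zs′ t′ bs′ x ×
       y ∈ bs′ × x ≺ y × (∀ {z} → c ≺ z → y ≺ z))
  climb-swap (there _) (stop l) = inj₁ ([] , stop l , ⊆-refl)
  climb-swap (there s) (below l g) with climb-swap s g
  ... | inj₁ (bs′ , g′ , ⊆bs′) = inj₁ (bs′ , below l g′ , ⊆bs′)
  ... | inj₂ (t′ , bs′ , x , y , t′<t , g′ , rest) =
        inj₂ (suc t′ , bs′ , x , y , s<s t′<t , below l g′ , rest)
  climb-swap (there s) (above p g) with climb-swap s g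
  ... | inj₁ (bs′ , g′ , ⊆bs′) = inj₁ (_ , above p g′ , ∷⁺ʳ _ ⊆bs′)
  ... | inj₂ (t′ , bs′ , x , y , t′<t , g′ , y∈ , x≺y , y≼c) =
        inj₂ (t′ , _ , x , y , t′<t , above (≺-trans x≺y (y≼c p)) g′ , there y∈ , x≺y , y≼c)
  climb-swap (here x≺y) (stop l) = inj₁ (_ , above x≺y (stop l) , λ ())
  climb-swap (here x≺y) (below l (stop _)) =
    inj₂ (0 , _ , _ , _ , z<s , above x≺y (stop l) , here refl , x≺y , id)
  climb-swap (here x≺y) (below l (below _ g)) =
    inj₂ (0 , _ , _ , _ , z<s , above x≺y (stop l) , here refl , x≺y , ≺-trans (climb-just g))
  climb-swap (here x≺y) (below l (above p g)) = inj₁ (_ , above p (below l g) , ⊆-refl)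
  climb-swap (here x≺y) (above p (stop _))    = contradiction x≺y (asym p)
  climb-swap (here x≺y) (above p (below l g)) =
    contradiction x≺y (asym (≺-trans (climb-just g) p))
  climb-swap (here x≺y) (above p (above q g)) =
    inj₁ (_ , above q (above p g) ,
          λ { (here e) → there (here e) ; (there (here e)) → here e ; (there (there e)) → there (there e) })

  -- How a climb changes when the entry y next to the cut is replaced by a smaller entry x.
  data Lowered (x y : ℕ) (rs : List ℕ) (t : ℕ) (bs : List ℕ) (c : ℕ) : Set where
    same : ∀ {bs′ c′} → Climb _≺_ nothing (x ∷ rs) t bs′ c′ → (∀ {z} → c ≺ z → c′ ≺ z) →
           (∀ {a} → Any (_≺ a) bs → Any (_≺ a) bs′) → (¬ c ≺ y) ⊎ (x ∈ bs′) →
           Lowered x y rs t bs c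
    more : ∀ {bs′} → Climb _≺_ nothing (x ∷ rs) (suc t) bs′ c → x ≺ c → c ≺ y →
           (∀ {a} → Any (_≺ a) bs → y ≺ a ⊎ Any (_≺ a) bs′) → Lowered x y rs t bs c
    fail : ∀ {bs′ r} → Climb _≺_ nothing (x ∷ rs) 0 (x ∷ bs′) r → r ≺ x → Lowered x y rs t bs c

  -- The first entry that is not a side entry decides: if it exceeds `x`, so does the whole chain;
  -- otherwise a climb of height 0 can end there.
  strengthen : x ∉ zs → x ≺ c → Climb _≺_ nothing zs t bs c →
    Climb _≺_ (just x) zs t bs c ⊎ (∃₂ λ bs′ r → Climb _≺_ nothing zs 0 bs′ r × r ≺ x)
  strengthen x∉ x≺c (stop _) = inj₁ (stop (just x≺c))
  strengthen {x} x∉ x≺c (below {x = r} _ g) with compare x r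
  ... | tri< x≺r _ _  = inj₁ (below (just x≺r) g)
  ... | tri≈ _ refl _ = contradiction (here refl) x∉
  ... | tri> _ _ r≺x  = inj₂ (_ , _ , stop nothing , r≺x)
  strengthen x∉ x≺c (above p g) with strengthen (x∉ ∘ there) x≺c g
  ... | inj₁ g′ = inj₁ (above p g′)
  ... | inj₂ (_ , _ , g′ , r≺x) = inj₂ (_ , _ , above (≺-trans (≺-trans r≺x x≺c) p) g′ , r≺x)

  climb-∈ : Climb _≺_ lo zs t bs c → c ∈ zs
  climb-∈ (stop _)    = here refl
  climb-∈ (below _ g) = there (climb-∈ g)
  climb-∈ (above _ g) = there (climb-∈ g)

  -- If `y` is the end or a chain entry, `x` takes its place. If `y` is a side entry, `x` is one too
  -- or starts the chain; should the old chain start below `x`, a climb of height 0 past the side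
  -- entry `x` remains.
  lower : x ∉ rs → x ≺ y → Climb _≺_ nothing (y ∷ rs) t bs c → Lowered x y rs t bs c
  lower x∉ x≺y (stop _) = same (stop nothing) (≺-trans x≺y) (λ ()) (inj₁ (≺-irrefl refl))
  lower x∉ x≺y (below _ g) =
    same (below nothing (weaken (λ { (just y≺z) → just (≺-trans x≺y y≺z) }) g)) id id
         (inj₁ (asym (climb-just g)))
  lower {x = x} {c = c} x∉ x≺y (above p g) with compare x c
  ... | tri> _ _ c≺x =
        same (above c≺x g) id
             (λ { (here y≺a) → here (≺-trans x≺y y≺a) ; (there q) → there q }) (inj₂ (here refl))
  ... | tri≈ _ refl _ = contradiction (climb-∈ g) x∉
  ... | tri< x≺c _ _ with strengthen x∉ x≺c g
  ...   | inj₁ g′ = more (below nothing g′) x≺c p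
                         (λ { (here y≺a) → inj₁ y≺a ; (there q) → inj₂ q })
  ...   | inj₂ (_ , _ , g′ , r≺x) = fail (above r≺x g′) r≺x

  precedes? : ∀ y x → y ≺ x ⊎ (∀ {a} → y ≺ a → x ≺ a)
  precedes? y x with compare y x
  ... | tri< y≺x _ _  = inj₁ y≺x
  ... | tri≈ _ refl _ = inj₂ id
  ... | tri> _ _ x≺y  = inj₂ (≺-trans x≺y)

  -- Going outwards from `x`, which exceeds `c`, the entries cannot increase all the way to `c`. The
  -- first descent met is undone; it leads from a side entry to a smaller entry, so chain and end
  -- survive.
  settle : c ≺ x → Climb _≺_ lo zs t bs c →
           ∃₂ λ zs′ bs′ → Swap _≺_ zs′ (x ∷ zs) × Climb _≺_ lo zs′ t bs′ c
  settle c≺x (stop l) = _ , _ , here c≺x , stop l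
  settle c≺x (below l g) = _ , _ , here (≺-trans (climb-just g) c≺x) , below l (above c≺x g)
  settle {x = x} c≺x (above {x = y} c≺y g) with precedes? y x | settle c≺y g
  ... | inj₁ y≺x | _             = _ , _ , here y≺x , above c≺y (above c≺x g)
  ... | inj₂ _   | _ , _ , s , g′ = _ , _ , there s , above c≺x g′

  -- As settle, but keeping an entry ≺ a; the only obstacle is that this entry is x and c is next to it.
  settle-middle : ∀ {a} → c ≺ x → Climb _≺_ lo zs t bs c → Any (_≺ a) (x ∷ bs) →
    (∃₂ λ zs′ bs′ → Swap _≺_ zs′ (x ∷ zs) × Climb _≺_ lo zs′ t bs′ c × Any (_≺ a) bs′) ⊎
    (∃ λ vs → zs ≡ c ∷ vs × t ≡ 0 × x ≺ a)
  settle-middle c≺x (stop l) (here x≺a) = inj₂ (_ , refl , refl , x≺a)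
  settle-middle c≺x (below l g) m =
    inj₁ (_ , _ , here (≺-trans (climb-just g) c≺x) , below l (above c≺x g) , m)
  settle-middle {x = x} c≺x (above {x = y} c≺y g) m with precedes? y x | m
  ... | inj₁ y≺x | m = inj₁ (_ , _ , here y≺x , above c≺y (above c≺x g) , exchange m)
    where
    exchange : ∀ {a bs} → Any (_≺ a) (x ∷ y ∷ bs) → Any (_≺ a) (y ∷ x ∷ bs)
    exchange (here p)          = there (here p)
    exchange (there (here p))  = here p
    exchange (there (there p)) = there (there p)
  ... | inj₂ x≼y | here x≺a with settle c≺y g
  ...   | _ , _ , s , g′ = inj₁ (_ , _ , there s , above c≺x g′ , here x≺a)
  settle-middle c≺x (above c≺y g) _ | inj₂ x≼y | there m with settle-middle c≺y g m
  ... | inj₁ (_ , _ , s , g′ , m′) = inj₁ (_ , _ , there s , above c≺x g′ , there m′)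
  -- Undoing the descent from `y` to `c` drops `y` from the side entries, but `x` is at most `y` and
  -- takes over as the entry `≺ a`.
  ... | inj₂ (_ , refl , refl , y≺a) =
        inj₁ (_ , _ , there (here c≺y) , above c≺x (stop (climb-lo g)) , here (x≼y y≺a))

open Half <-isStrictTotalOrder
module Dual = Half (isStrictTotalOrder <-isStrictTotalOrder)

-- Fact (1) for a descent in the right half. If the climb breaks, the left climb is shortened to the
-- new height, which raises `top`; the entry `y` that left the chain is then the middle one.
pinch-swapʳ : Swap _<_ rs rs′ → Pinch _<_ ls rs → Pinch _<_ ls rs′
pinch-swapʳ s (pinch gˡ gʳ c<a m) with climb-swap s gʳ
... | inj₁ (_ , gʳ′ , ⊆bs′) = pinch gˡ gʳ′ c<a (map₂ (Any-resp-⊆ ⊆bs′) m)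
... | inj₂ (_ , _ , _ , _ , t′<t , gʳ′ , y∈ , x<y , y≤c) with Dual.climb-drop gˡ t′<t
...   | _ , _ , gˡ′ , a<a′ =
        pinch gˡ′ gʳ′ (<-trans x<y y<a′) (inj₂ (lose y∈ y<a′))
        where y<a′ = <-trans (y≤c c<a) a<a′

pinch-swapˡ : Swap (flip _<_) ls ls′ → Pinch _<_ ls rs → Pinch _<_ ls′ rs
pinch-swapˡ s (pinch gˡ gʳ c<a m) with Dual.climb-swap s gˡ
... | inj₁ (_ , gˡ′ , ⊆bs′) = pinch gˡ′ gʳ c<a (map₁ (Any-resp-⊆ ⊆bs′) m)
... | inj₂ (_ , _ , _ , _ , t′<t , gˡ′ , y∈ , y<x , a≤y) with climb-drop gʳ t′<t
...   | _ , _ , gʳ′ , c′<c =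
        pinch gˡ′ gʳ′ (<-trans c′<y y<x) (inj₁ (lose y∈ c′<y))
        where c′<y = <-trans c′<c (a≤y c<a)

-- Fact (1) for a descent at the cut. If both heights change alike, `top` is not lowered, `bottom`
-- is not raised and the middle entry persists; a failure on either side leaves a pinch of height 0
-- that uses both exchanged entries.
pinch-cut : x ∉ rs → y ∉ ls → x < y → Pinch _<_ (x ∷ ls) (y ∷ rs) → Pinch _<_ (y ∷ ls) (x ∷ rs)
pinch-cut x∉ y∉ x<y (pinch gˡ gʳ c<a m) with lower x∉ x<y gʳ | Dual.lower y∉ x<y gˡ
... | fail gʳ′ r<x | _ =
      pinch (stop nothing) gʳ′ (<-trans r<x x<y) (inj₂ (here x<y))
... | _ | Dual.fail gˡ′ y<r =
      pinch gˡ′ (stop nothing) (<-trans x<y y<r) (inj₁ (here x<y))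
... | same gʳ′ c′≤c keepʳ _ | Dual.same gˡ′ a≤a′ keepˡ _ =
      pinch gˡ′ gʳ′ (a≤a′ (c′≤c c<a))
        ([ inj₁ ∘ Any.map c′≤c ∘ keepˡ , inj₂ ∘ Any.map a≤a′ ∘ keepʳ ]′ m)
... | more gʳ′ x<c c<y keepʳ | Dual.more gˡ′ a<y x<a keepˡ = pinch gˡ′ gʳ′ c<a (middle m)
  where
  middle : Any _ _ ⊎ Any _ _ → Any _ _ ⊎ Any _ _
  middle (inj₁ q) with keepˡ q
  ... | inj₁ c<x = contradiction c<x (<-asym x<c)
  ... | inj₂ q′  = inj₁ q′
  middle (inj₂ q) with keepʳ q
  ... | inj₁ y<a = contradiction y<a (<-asym a<y)
  ... | inj₂ q′  = inj₂ q′
-- Only the right chain has grown, so it is cut back by one; `y`, now next to the cut on the left,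
-- is the middle entry.
... | more gʳ′ x<c c<y _ | Dual.same gˡ′ a≤a′ _ y∈ with climb-drop gʳ′ ≤-refl
...   | _ , _ , gʳ″ , c′<c =
        pinch gˡ′ gʳ″ (a≤a′ (<-trans c′<c c<a))
          (inj₁ (lose ([ contradiction (<-trans x<c c<a) , id ]′ y∈) (<-trans c′<c c<y)))
pinch-cut x∉ y∉ x<y (pinch gˡ gʳ c<a m)
    | same gʳ′ c′≤c _ x∈ | Dual.more gˡ′ a<y x<a _ with Dual.climb-drop gˡ′ ≤-refl
...   | _ , _ , gˡ″ , a<a′ =
        pinch gˡ″ gʳ′ (c′≤c (<-trans c<a a<a′))
          (inj₂ (lose ([ contradiction (<-trans c<a a<y) , id ]′ x∈) (<-trans x<a a<a′)))

-- The outcomes of fact (2): a descent undone in one half or across the cut, or a decreasing triple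
-- whose middle entry lies just left or just right of the cut.
data PinchDescent (ls rs : List ℕ) : Set where
  left   : Swap (flip _<_) ls′ ls → Pinch _<_ ls′ rs → PinchDescent ls rs
  right  : Swap _<_ rs′ rs → Pinch _<_ ls rs′ → PinchDescent ls rs
  across : ls ≡ x ∷ ls′ → rs ≡ y ∷ rs′ → y < x → Pinch _<_ (y ∷ ls′) (x ∷ rs′) → PinchDescent ls rs
  tripleˡ : ∀ {a p c} → ls ≡ p ∷ a ∷ ls′ → rs ≡ c ∷ rs′ → c < p → p < a → PinchDescent ls rs
  tripleʳ : ∀ {a p c} → ls ≡ a ∷ ls′ → rs ≡ p ∷ c ∷ rs′ → c < p → p < a → PinchDescent ls rs

pinch-descent : Pinch _<_ ls rs → PinchDescent ls rs
-- Both halves begin with chain entries, and `y < bottom < top < x`. Exchanging `x` and `y` turns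
-- both into side entries and lowers the two heights together.
pinch-descent (pinch (below _ gˡ) (below _ gʳ) c<a m) =
  across refl refl (<-trans y<c (<-trans c<a a<x))
    (pinch (above (<-trans y<c c<a) (Dual.forget gˡ)) (above (<-trans c<a a<x) (forget gʳ)) c<a
           (Sum.map there there m))
  where
  y<c = climb-just gʳ
  a<x = Dual.climb-just gˡ
pinch-descent (pinch (above x<a gˡ) gʳ c<a (inj₂ m)) with Dual.settle x<a gˡ
... | _ , _ , s , gˡ′ = left s (pinch gˡ′ gʳ c<a (inj₂ m))
pinch-descent (pinch gˡ (above c<y gʳ) c<a (inj₁ m)) with settle c<y gʳ
... | _ , _ , s , gʳ′ = right s (pinch gˡ gʳ′ c<a (inj₁ m))
pinch-descent (pinch (above x<a gˡ) gʳ@(stop _) c<a (inj₁ m)) with Dual.settle-middle x<a gˡ m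
... | inj₁ (_ , _ , s , gˡ′ , m′) = left s (pinch gˡ′ gʳ c<a (inj₁ m′))
... | inj₂ (_ , refl , _ , c<x)   = tripleˡ refl refl c<x x<a
-- The obstacle in `settle-middle` has height 0, which a right climb starting with `below` excludes.
pinch-descent (pinch (above x<a gˡ) gʳ@(below _ _) c<a (inj₁ m)) with Dual.settle-middle x<a gˡ m
... | inj₁ (_ , _ , s , gˡ′ , m′) = left s (pinch gˡ′ gʳ c<a (inj₁ m′))
pinch-descent (pinch gˡ@(stop _) (above c<y gʳ) c<a (inj₂ m)) with settle-middle c<y gʳ m
... | inj₁ (_ , _ , s , gʳ′ , m′) = right s (pinch gˡ gʳ′ c<a (inj₂ m′))
... | inj₂ (_ , refl , _ , y<a)   = tripleʳ refl refl c<y y<a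
pinch-descent (pinch gˡ@(below _ _) (above c<y gʳ) c<a (inj₂ m)) with settle-middle c<y gʳ m
... | inj₁ (_ , _ , s , gʳ′ , m′) = right s (pinch gˡ gʳ′ c<a (inj₂ m′))

-- Adjacent transpositions of sequences and inversions

-- Agreement is asked only below `m`, because in the left half the truncated subtraction `k ∸ suc q`
-- sends every larger index to 0.
record Transposed (d m : ℕ) (g g′ : ℕ → ℕ) : Set where
  field
    at-d   : g′ d ≡ g (suc d)
    at-suc : g′ (suc d) ≡ g d
    off    : ∀ {q} → q < m → q ≢ d → q ≢ suc d → g′ q ≡ g q
open Transposed

private variable
  d e k m n a b : ℕ
  g g′ f : ℕ → ℕ
  as u v : List ℕ
  _≺_ : Rel ℕ 0ℓ

transposed-sym : Transposed d m g g′ → Transposed d m g′ g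
transposed-sym T = record
  { at-d = sym (at-suc T) ; at-suc = sym (at-d T) ; off = λ q<m q≢d q≢1+d → sym (off T q<m q≢d q≢1+d) }

transposed-tail : Transposed (suc d) (suc m) g g′ → Transposed d m (g ∘ suc) (g′ ∘ suc)
transposed-tail T = record
  { at-d = at-d T ; at-suc = at-suc T
  ; off = λ q<m q≢d q≢1+d → off T (s<s q<m) (q≢d ∘ suc-injective) (q≢1+d ∘ suc-injective) }

applyUpTo-cong : ∀ m → (∀ {q} → q < m → g q ≡ g′ q) → applyUpTo g m ≡ applyUpTo g′ m
applyUpTo-cong zero    eq = refl
applyUpTo-cong (suc m) eq = cong₂ _∷_ (eq z<s) (applyUpTo-cong m (eq ∘ s<s))

applyUpTo-swap : suc d < m → Transposed d m g g′ → g d ≺ g (suc d) →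
                 Swap _≺_ (applyUpTo g m) (applyUpTo g′ m)
applyUpTo-swap {d = zero} {m = suc (suc m)} {g} {g′} (s<s _) T lt
  rewrite at-d T | at-suc T
        | applyUpTo-cong {g = g′ ∘ suc ∘ suc} {g′ = g ∘ suc ∘ suc} m (λ q<m → off T (s<s (s<s q<m)) (λ ()) (λ ()))
  = here lt
applyUpTo-swap {d = suc d} {m = suc m} (s<s d<m) T lt
  rewrite off T z<s (λ ()) (λ ()) = there (applyUpTo-swap d<m (transposed-tail T) lt)

-- The quantification over `g′` allows `zs` to be recognised as a half of `f ∘ τ d` once the
-- position of the swap is known.
applyUpTo-swap⁻¹ : ∀ m → Swap _≺_ zs (applyUpTo g m) →
  ∃ λ d → suc d < m × g (suc d) ≺ g d × (∀ {g′} → Transposed d m g g′ → zs ≡ applyUpTo g′ m)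
applyUpTo-swap⁻¹ {g = g} (suc (suc m)) (here lt) = 0 , s<s z<s , lt , λ T →
  cong₂ _∷_ (sym (at-d T)) (cong₂ _∷_ (sym (at-suc T))
    (applyUpTo-cong m (λ q<m → sym (off T (s<s (s<s q<m)) (λ ()) (λ ())))))
applyUpTo-swap⁻¹ (suc m) (there s) with applyUpTo-swap⁻¹ m s
... | d , d<m , lt , unique = suc d , s<s d<m , lt , λ T →
  cong₂ _∷_ (sym (off T z<s (λ ()) (λ ()))) (unique (transposed-tail T))

inversions : List ℕ → ℕ
inversions []       = 0
inversions (x ∷ xs) = length (filter (_<? x) xs) + inversions xs

swap⇒↭ : Swap _≺_ zs zs′ → zs ↭ zs′
swap⇒↭ (here _)  = ↭.swap _ _ ↭.refl
swap⇒↭ (there s) = ↭.prep _ (swap⇒↭ s)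

inversions-swap : Swap _<_ zs zs′ → inversions zs′ ≡ suc (inversions zs)
inversions-swap {zs = x ∷ y ∷ zs} (here x<y)
  rewrite filter-accept (_<? y) {xs = zs} x<y | filter-reject (_<? x) {xs = zs} (<-asym x<y)
  = cong suc (+-comm-middle (length (filter (_<? y) zs)) (length (filter (_<? x) zs)) (inversions zs))
  where
  +-comm-middle : ∀ a b c → a + (b + c) ≡ b + (a + c)
  +-comm-middle a b c = trans (sym (+-assoc a b c)) (trans (cong (_+ c) (+-comm a b)) (+-assoc b a c))
inversions-swap {zs = x ∷ zs} {zs′ = _ ∷ zs′} (there s)
  rewrite inversions-swap s | ↭-length (filter-↭ (_<? x) (swap⇒↭ s)) = +-suc _ _

inversions-increasing : ∀ m → (∀ {p q} → p < q → q < m → g p < g q) → inversions (applyUpTo g m) ≡ 0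
inversions-increasing zero    inc = refl
inversions-increasing {g} (suc m) inc
  rewrite filter-none (_<? g 0) (All.applyUpTo⁺₁ (g ∘ suc) m (λ q<m → <-asym (inc z<s (s<s q<m))))
  = inversions-increasing m (λ p<q q<m → inc (s<s p<q) (s<s q<m))

-- Simple reflections and the Coxeter relations.

-- Opaque, because conversion checking is very slow when σ unfolds inside iterated compositions.
opaque
  τ : ℕ → ℕ → ℕ
  τ d = σ (suc d)

  τ-lower : ∀ d → τ d d ≡ suc d
  τ-lower d with suc d ≟ suc d
  ... | yes _ = refl
  ... | no ¬p = contradiction refl ¬p

  τ-upper : ∀ d → τ d (suc d) ≡ d
  τ-upper d with suc (suc d) ≟ suc d
  ... | yes p = contradiction p (1+n≢n)
  ... | no _ with suc d ≟ suc d
  ...   | yes _ = refl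
  ...   | no ¬p = contradiction refl ¬p

  τ-fixed : x ≢ d → x ≢ suc d → τ d x ≡ x
  τ-fixed {x} {d} x≢d x≢1+d with suc x ≟ suc d
  ... | yes p = contradiction (suc-injective p) x≢d
  ... | no _ with x ≟ suc d
  ...   | yes p = contradiction p x≢1+d
  ...   | no _ = refl

data Place (d x : ℕ) : Set where
  low : x ≡ d → Place d x
  high : x ≡ suc d → Place d x
  other : x ≢ d → x ≢ suc d → Place d x

place : ∀ d x → Place d x
place d x with x ≟ d | x ≟ suc d
... | yes p | _     = low p
... | no _  | yes p = high p
... | no p  | no q  = other p q

τ-involutive : ∀ d x → τ d (τ d x) ≡ x
τ-involutive d x with place d x
... | low refl = trans (cong (τ d) (τ-lower d)) (τ-upper d)
... | high refl = trans (cong (τ d) (τ-upper d)) (τ-lower d)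
... | other p q  = trans (cong (τ d) (τ-fixed p q)) (τ-fixed p q)

τ-bounded : suc d < n → x < n → τ d x < n
τ-bounded {d} {n} {x} d<n x<n with place d x
... | low refl = subst (_< n) (sym (τ-lower d)) d<n
... | high refl = subst (_< n) (sym (τ-upper d)) (<-trans (n<1+n d) d<n)
... | other p q  = subst (_< n) (sym (τ-fixed p q)) x<n

τ-commute : suc d < e → ∀ x → τ e (τ d x) ≡ τ d (τ e x)
τ-commute {d} {e} d+1<e x with place d x | place e x
... | low refl | low refl = contradiction d+1<e (<-asym (n<1+n _))
... | low refl | high refl = contradiction d+1<e (<-asym (m<n⇒m<1+n (n<1+n _)))
... | low refl | other p q rewrite τ-fixed p q | τ-lower d =
      τ-fixed (<⇒≢ d+1<e) (<⇒≢ (m<n⇒m<1+n d+1<e))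
... | high refl | low refl = contradiction d+1<e (<-irrefl refl)
... | high refl | high refl = contradiction d+1<e (<-asym (n<1+n _))
... | high refl | other p q rewrite τ-fixed p q | τ-upper d =
      τ-fixed (<⇒≢ (<-trans (n<1+n _) d+1<e)) (<⇒≢ (m<n⇒m<1+n (<-trans (n<1+n _) d+1<e)))
... | other p q | low refl rewrite τ-fixed p q | τ-lower x =
      sym (τ-fixed (>⇒≢ (<-trans (n<1+n _) (m<n⇒m<1+n d+1<e))) (>⇒≢ (m<n⇒m<1+n d+1<e)))
... | other p q | high refl rewrite τ-fixed p q | τ-upper e =
      sym (τ-fixed (>⇒≢ (<-trans (n<1+n _) d+1<e)) (>⇒≢ d+1<e))
... | other p q | other p′ q′ rewrite τ-fixed p q | τ-fixed p′ q′ = sym (τ-fixed p q)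

τ-braid : ∀ d x → τ d (τ (suc d) (τ d x)) ≡
                  τ (suc d) (τ d (τ (suc d) x))
τ-braid d x with place d x | place (suc d) x
... | low refl | low ()
... | low refl | high ()
... | low refl | other p q
  rewrite τ-fixed p q | τ-lower d | τ-lower (suc d) = τ-fixed (>⇒≢ (m<n⇒m<1+n (n<1+n d))) 1+n≢n
... | high refl | low refl
  rewrite τ-upper d | τ-lower (suc d) | τ-fixed {d} {suc d} (<⇒≢ (n<1+n d)) (<⇒≢ (m<n⇒m<1+n (n<1+n d))) | τ-lower d
        | τ-fixed {suc (suc d)} {d} (>⇒≢ (m<n⇒m<1+n (n<1+n d))) 1+n≢n | τ-upper (suc d) = refl
... | high refl | high ()
... | high refl | other p q = contradiction refl p
... | other p q | low refl = contradiction refl q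
... | other p q | high refl
  rewrite τ-fixed p q | τ-upper (suc d) | τ-upper d = sym (τ-fixed (<⇒≢ (n<1+n d)) (<⇒≢ (m<n⇒m<1+n (n<1+n d))))
... | other p q | other p′ q′
  rewrite τ-fixed p q | τ-fixed p′ q′ | τ-fixed p q = sym (τ-fixed p′ q′)

τ-transposed : Transposed d n f (f ∘ τ d)
τ-transposed {d} {f = f} = record
  { at-d = cong f (τ-lower d) ; at-suc = cong f (τ-upper d) ; off = λ _ p q → cong f (τ-fixed p q) }

-- Reduced words

-- Functions on all of `ℕ` keep `f ∘ τ d` free of bounds; injectivity is global, as `extend`
-- continues a permutation by the identity.
record Perm (n : ℕ) (f : ℕ → ℕ) : Set where
  constructor perm
  field
    bounded   : x < n → f x < n
    injective : f x ≡ f y → x ≡ y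
open Perm

perm-τ : suc d < n → Perm n f → Perm n (f ∘ τ d)
perm-τ {d} d<n P = perm (λ x<n → bounded P (τ-bounded d<n x<n))
  (λ {x} {y} eq → trans (sym (τ-involutive d x)) (trans (cong (τ d) (injective P eq)) (τ-involutive d y)))

record Spells (n : ℕ) (f : ℕ → ℕ) (as : List ℕ) : Set where
  constructor spells
  field
    valid : All (ValidLetter n) as
    eval  : ∀ {x} → x < n → evalWord as x ≡ f x
open Spells

inv : ℕ → (ℕ → ℕ) → ℕ
inv n f = inversions (applyUpTo f n)

opaque
  unfolding τ

  evalWord-∷ʳ : ∀ as → evalWord (as ∷ʳ suc d) x ≡ evalWord as (τ d x)
  evalWord-∷ʳ []       = refl
  evalWord-∷ʳ (b ∷ as) = cong (σ b) (evalWord-∷ʳ as)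

length-∷ʳ : ∀ (as : List ℕ) → length (as ∷ʳ a) ≡ suc (length as)
length-∷ʳ as = trans (length-++ as) (+-comm (length as) 1)

occ-∷ʳ : ∀ as → occ k (as ∷ʳ a) ≡ occ k as + occ k (a ∷ [])
occ-∷ʳ []       = refl
occ-∷ʳ {k} (b ∷ as) with b ≟ k
... | yes _ = cong suc (occ-∷ʳ as)
... | no _  = occ-∷ʳ as

occ-same : occ k (k ∷ []) ≡ 1
occ-same {k} with k ≟ k
... | yes _ = refl
... | no ¬p = contradiction refl ¬p

occ-different : a ≢ k → occ k (a ∷ []) ≡ 0
occ-different {a} {k} a≢k with a ≟ k
... | yes p = contradiction p a≢k
... | no _  = refl

spells-cong : (∀ x → f x ≡ g x) → Spells n f as → Spells n g as
spells-cong f≗g S = spells (valid S) (λ x<n → trans (eval S x<n) (f≗g _))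

spells-∷ʳ : suc d < n → Spells n (f ∘ τ d) as → Spells n f (as ∷ʳ suc d)
spells-∷ʳ {d} {f = f} {as} d<n S = spells (All.∷ʳ⁺ (valid S) (s≤s z≤n , d<n)) λ {x} x<n →
  trans (evalWord-∷ʳ as) (trans (eval S (τ-bounded d<n x<n)) (cong f (τ-involutive d x)))

spells-∷ʳ⁻ : Spells n f (as ∷ʳ suc d) → suc d < n × Spells n (f ∘ τ d) as
spells-∷ʳ⁻ {n} {f} {as} {d} S with All.∷ʳ⁻ (valid S)
... | valid-as , _ , d<n = d<n , spells valid-as λ {x} x<n → begin
  evalWord as x                          ≡⟨ cong (evalWord as) (τ-involutive d x) ⟨
  evalWord as (τ d (τ d x))  ≡⟨ evalWord-∷ʳ as ⟨
  evalWord (as ∷ʳ suc d) (τ d x)   ≡⟨ eval S (τ-bounded d<n x<n) ⟩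
  f (τ d x)                        ∎
  where open ≡-Reasoning

Descent : ℕ → (ℕ → ℕ) → ℕ → Set
Descent n f d = suc d < n × f (suc d) < f d

inv-descent : Descent n f d → inv n f ≡ suc (inv n (f ∘ τ d))
inv-descent {f = f} {d = d} (d<n , lt) = inversions-swap
  (applyUpTo-swap d<n (transposed-sym τ-transposed)
    (subst₂ _<_ (cong f (sym (τ-lower d))) (cong f (sym (τ-upper d))) lt))

inv-ascent : suc d < n → f d < f (suc d) → inv n (f ∘ τ d) ≡ suc (inv n f)
inv-ascent d<n lt = inversions-swap (applyUpTo-swap d<n τ-transposed lt)

descent-or-ascent : Perm n f → ∀ d → f (suc d) < f d ⊎ f d < f (suc d)
descent-or-ascent {f = f} P d with <-cmp (f (suc d)) (f d)
... | tri< lt _ _ = inj₁ lt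
... | tri≈ _ eq _ = contradiction (injective P eq) 1+n≢n
... | tri> _ _ gt = inj₂ gt

identity-inv : ∀ n → (∀ {x} → x < n → x ≡ f x) → inv n f ≡ 0
identity-inv n eq = inversions-increasing n (λ p<q q<n → subst₂ _<_ (eq (<-trans p<q q<n)) (eq q<n) p<q)

-- Each letter changes the number of inversions by exactly one. The recursion runs on `l`, since
-- splitting off the last letter is not structural on the list.
inv≤length : ∀ l as → length as ≡ l → Perm n f → Spells n f as → inv n f ≤ l
inv≤length l as len P S with initLast as
inv≤length {n} l .[] refl P S | [] = ≤-reflexive (identity-inv n (eval S))
inv≤length l .(as ∷ʳ a) len P S | as ∷ʳ′ a with All.∷ʳ⁻ (valid S)
inv≤length zero .(as ∷ʳ a) len P S | as ∷ʳ′ a | _ = contradiction (trans (sym (length-∷ʳ as)) len) λ ()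
inv≤length (suc l) .(as ∷ʳ suc d) len P S | as ∷ʳ′ suc d | _ , s≤s z≤n , _
  with spells-∷ʳ⁻ {as = as} S | descent-or-ascent P d
... | d<n , S′ | inj₁ lt = ≤-trans (≤-reflexive (inv-descent (d<n , lt)))
      (s≤s (inv≤length l as (suc-injective (trans (sym (length-∷ʳ as)) len)) (perm-τ d<n P) S′))
... | d<n , S′ | inj₂ gt = ≤-trans (n≤1+n _) (≤-trans (≤-reflexive (sym (inv-ascent d<n gt))) (m≤n⇒m≤1+n
      (inv≤length l as (suc-injective (trans (sym (length-∷ʳ as)) len)) (perm-τ d<n P) S′)))

-- Reducedness measured by inversions; `reduced⇒shortest` and `shortest⇒reduced` match it with
-- minimal length.
record Shortest (n : ℕ) (f : ℕ → ℕ) (as : List ℕ) : Set where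
  constructor shortest
  field
    word       : Spells n f as
    length≡inv : length as ≡ inv n f
open Shortest

shortest-cong : (∀ x → f x ≡ g x) → Shortest n f as → Shortest n g as
shortest-cong {n = n} f≗g S = shortest (spells-cong f≗g (word S))
  (trans (length≡inv S) (cong inversions (applyUpTo-cong n (λ _ → f≗g _))))

shortest-∷ʳ : Descent n f d → Shortest n (f ∘ τ d) as → Shortest n f (as ∷ʳ suc d)
shortest-∷ʳ {as = as} D@(d<n , _) S = shortest (spells-∷ʳ d<n (word S))
  (trans (length-∷ʳ as) (trans (cong suc (length≡inv S)) (sym (inv-descent D))))

-- Were the last letter an ascent, `f ∘ τ d` would have more inversions than `f`, yet be spelled by
-- fewer letters than `f` has inversions.
shortest-∷ʳ⁻ : Perm n f → Shortest n f (as ∷ʳ suc d) →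
               Descent n f d × Shortest n (f ∘ τ d) as
shortest-∷ʳ⁻ {n} {f} {as} {d} P S with spells-∷ʳ⁻ {as = as} (word S) | descent-or-ascent P d
... | d<n , S′ | inj₁ lt = (d<n , lt) , shortest S′ (suc-injective
      (trans (sym (length-∷ʳ as)) (trans (length≡inv S) (inv-descent (d<n , lt)))))
... | d<n , S′ | inj₂ gt = contradiction too-long (<-irrefl refl)
  where
  open ≤-Reasoning
  too-long : length as < length as
  too-long = begin-strict
    length as               <⟨ n<1+n _ ⟩
    suc (length as)         ≡⟨ length-∷ʳ as ⟨
    length (as ∷ʳ suc d)    ≡⟨ length≡inv S ⟩
    inv n f                 <⟨ n<1+n _ ⟩
    suc (inv n f)           ≡⟨ inv-ascent d<n gt ⟨
    inv n (f ∘ τ d)   ≤⟨ inv≤length _ as refl (perm-τ d<n P) S′ ⟩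
    length as               ∎

descent? : ∀ n f → Dec (∃ λ d → d < n × Descent n f d)
descent? n f = anyUpTo? (λ d → (suc d <? n) ×-dec (f (suc d) <? f d)) n

-- Without descents `f` increases, so `x ≤ f x`. The `e` further steps up to the last index give
-- `f x + e ≤ f (x + e) ≤ x + e`, hence `f x ≤ x`.
no-descent⇒identity : Perm n f → ¬ (∃ λ d → d < n × Descent n f d) → x < n → x ≡ f x
no-descent⇒identity {n} {f} {x} P none x<n with m≤n⇒∃[o]m+o≡n x<n
... | e , refl = ≤-antisym (expanding x x<n) (+-cancelʳ-≤ e (f x) x
        (s≤s⁻¹ (≤-<-trans (shift e (n<1+n _)) (bounded P (n<1+n _)))))
  where
  ascent : ∀ {d} → suc d < n → f d < f (suc d)
  ascent {d} d<n with descent-or-ascent P d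
  ... | inj₁ lt = contradiction (d , <-trans (n<1+n d) d<n , d<n , lt) none
  ... | inj₂ gt = gt
  expanding : ∀ x → x < n → x ≤ f x
  expanding zero    _   = z≤n
  expanding (suc x) x<n = ≤-<-trans (expanding x (<-trans (n<1+n x) x<n)) (ascent x<n)
  shift : ∀ e → x + e < n → f x + e ≤ f (x + e)
  shift zero    _ rewrite +-identityʳ x | +-identityʳ (f x) = ≤-refl
  shift (suc e) lt rewrite +-suc x e | +-suc (f x) e =
    ≤-<-trans (shift e (<-trans (n<1+n _) lt)) (ascent lt)

shortest-exists : ∀ l → Perm n f → inv n f ≡ l → ∃ (Shortest n f)
shortest-exists {n} {f} l P eq with descent? n f
... | no none = [] , shortest (spells [] (no-descent⇒identity P none))
                              (sym (identity-inv n (no-descent⇒identity P none)))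
shortest-exists zero P eq | yes (d , _ , D) = contradiction (trans (sym eq) (inv-descent D)) λ ()
shortest-exists (suc l) P eq | yes (d , _ , D)
  with shortest-exists l (perm-τ (proj₁ D) P) (suc-injective (trans (sym (inv-descent D)) eq))
... | as , S = as ∷ʳ suc d , shortest-∷ʳ D S

-- Pinches and descents

-- The index `q` is the distance from the cut, so this half is read from right to left.
leftHalf : ℕ → (ℕ → ℕ) → List ℕ
leftHalf k f = applyUpTo (λ q → f (k ∸ suc q)) k

rightHalf : ℕ → ℕ → (ℕ → ℕ) → List ℕ
rightHalf k m f = applyUpTo (λ q → f (q + k)) m

PinchAt : ℕ → ℕ → (ℕ → ℕ) → Set
PinchAt k m f = Pinch _<_ (leftHalf k f) (rightHalf k m f)

mirror : ∀ {q k d} → q < k → k ∸ suc q ≡ d → q ≡ k ∸ suc d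
mirror {q} {k} q<k refl = sym (trans (cong (k ∸_) (sym (+-∸-assoc 1 q<k))) (m∸[m∸n]≡n (<⇒≤ q<k)))

-- With `k` written as `2 + d + e`, positions `d` and `suc d` lie at distances `suc e` and `e` from
-- the cut.
leftHalf-transposed : ∀ {e d} {f : ℕ → ℕ} → Transposed e (suc (suc (d + e))) (λ q → f (suc (suc (d + e)) ∸ suc q))
                                 (λ q → f (τ d (suc (suc (d + e)) ∸ suc q)))
leftHalf-transposed {e} {d} {f} = record
  { at-d   = cong f (trans (cong (τ d) (m+n∸n≡m (suc d) e)) (trans (τ-upper d) (sym (m+n∸n≡m d e))))
  ; at-suc = cong f (trans (cong (τ d) (m+n∸n≡m d e)) (trans (τ-lower d) (sym (m+n∸n≡m (suc d) e))))
  ; off    = λ q<k q≢e q≢1+e → cong f (τ-fixed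
      (λ eq → q≢1+e (trans (mirror q<k eq) (trans (cong (_∸ d) (sym (+-suc d e))) (m+n∸m≡n d (suc e)))))
      (λ eq → q≢e (trans (mirror q<k eq) (m+n∸m≡n d e))))
  }

rightHalf-transposed : ∀ {d m k} {f : ℕ → ℕ} → Transposed d m (λ q → f (q + k)) (λ q → f (τ (d + k) (q + k)))
rightHalf-transposed {d} {k = k} {f} = record
  { at-d   = cong f (τ-lower (d + k))
  ; at-suc = cong f (τ-upper (d + k))
  ; off    = λ _ q≢d q≢1+d → cong f (τ-fixed (q≢d ∘ +-cancelʳ-≡ k _ _) (q≢1+d ∘ +-cancelʳ-≡ k _ _))
  }

leftHalf-τ : ∀ {k d f} → k ≤ d → leftHalf k (f ∘ τ d) ≡ leftHalf k f
leftHalf-τ {suc k} {d} {f} k<d = applyUpTo-cong (suc k) λ {q} _ →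
  cong f (τ-fixed (<⇒≢ (≤-<-trans (m∸n≤m k q) k<d)) (<⇒≢ (≤-<-trans (m∸n≤m k q) (m<n⇒m<1+n k<d))))
leftHalf-τ {zero} _ = refl

rightHalf-τ : ∀ {d k m f} → suc d < k → rightHalf k m (f ∘ τ d) ≡ rightHalf k m f
rightHalf-τ {d} {k} {m} {f} d<k = applyUpTo-cong m λ {q} _ →
  cong f (τ-fixed (>⇒≢ (<-≤-trans (<-trans (n<1+n d) d<k) (m≤n+m k q))) (>⇒≢ (<-≤-trans d<k (m≤n+m k q))))

leftHalf-cut : ∀ {d f} → leftHalf (suc d) (f ∘ τ d) ≡ f (suc d) ∷ leftHalf d f
leftHalf-cut {d} {f} = cong₂ _∷_ (cong f (τ-lower d)) (leftHalf-τ {f = f} ≤-refl)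

rightHalf-cut : ∀ {d m f} → rightHalf (suc d) (suc m) (f ∘ τ d) ≡ f d ∷ applyUpTo (λ q → f (suc q + suc d)) m
rightHalf-cut {d} {m} {f} = cong₂ _∷_ (cong f (τ-upper d)) (applyUpTo-cong m λ {q} _ →
  cong f (τ-fixed (>⇒≢ (m<n⇒m<1+n (m≤n+m (suc d) q))) (>⇒≢ (s≤s (m≤n+m (suc d) q)))))

pinchAt-cut : ∀ {n f d m} → Perm n f → f (suc d) < f d →
              PinchAt (suc d) (suc m) (f ∘ τ d) → PinchAt (suc d) (suc m) f
pinchAt-cut {f = f} {d} {m} P lt w = pinch-cut right∌ left∌ lt
  (subst₂ (Pinch _<_) (leftHalf-cut {f = f}) (rightHalf-cut {m = m} {f = f}) w)
  where
  right∌ : f (suc d) ∉ applyUpTo (λ q → f (suc q + suc d)) m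
  right∌ y∈ with ∈-applyUpTo⁻ (λ q → f (suc q + suc d)) y∈
  ... | q , _ , eq = <-irrefl (injective P eq) (s≤s (m≤n+m (suc d) q))
  left∌ : f d ∉ leftHalf d f
  left∌ x∈ with ∈-applyUpTo⁻ (λ q → f (d ∸ suc q)) x∈
  ... | q , q<d , eq = <-irrefl (sym (injective P eq)) (∸-monoʳ-< z<s q<d)

-- Fact (1) for functions. The cut lies just before the 0-based position `k`, so comparing `suc d`
-- with `k` tells whether the descent is left of it, across it or right of it.
pinchAt-ascend : ∀ {m k f d} → Perm (m + k) f → Descent (m + k) f d → PinchAt k m (f ∘ τ d) → PinchAt k m f
pinchAt-ascend {m} {k} {f} {d} P (d<n , lt) w with <-cmp (suc d) k
... | tri< d<k _ _ with m≤n⇒∃[o]m+o≡n d<k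
...   | e , refl = pinch-swapˡ
        (applyUpTo-swap (s≤s (s≤s (m≤n+m e d))) (transposed-sym (leftHalf-transposed {e} {d} {f}))
          (subst₂ _<_ (cong f (sym (trans (cong (τ d) (m+n∸n≡m d e)) (τ-lower d))))
                      (cong f (sym (trans (cong (τ d) (m+n∸n≡m (suc d) e)) (τ-upper d)))) lt))
        (subst (Pinch _<_ _) (rightHalf-τ {m = m} {f = f} d<k) w)
pinchAt-ascend {zero}  P (d<n , lt) w | tri≈ _ refl _ = contradiction d<n (<-irrefl refl)
pinchAt-ascend {suc m} P (d<n , lt) w | tri≈ _ refl _ = pinchAt-cut {m = m} P lt w
pinchAt-ascend {m} {k} {f} {d} P (d<n , lt) w | tri> _ _ k<d with m≤n⇒∃[o]m+o≡n (s≤s⁻¹ k<d)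
... | e , refl rewrite +-comm k e = pinch-swapʳ
        (applyUpTo-swap (+-cancelʳ-< k _ _ d<n) (transposed-sym (rightHalf-transposed {e} {m} {k} {f}))
           (subst₂ _<_ (cong f (sym (τ-lower (e + k)))) (cong f (sym (τ-upper (e + k)))) lt))
        (subst (λ ls → Pinch _<_ ls (rightHalf k m (f ∘ τ (e + k)))) (leftHalf-τ {f = f} (s≤s⁻¹ k<d)) w)

Triple : ℕ → (ℕ → ℕ) → ℕ → Set
Triple n f d = suc (suc d) < n × f (suc d) < f d × f (suc (suc d)) < f (suc d)

triple⇒pinchAt : ∀ {m k f d} → Triple (m + k) f d → k ≡ suc d ⊎ k ≡ suc (suc d) → PinchAt k m f
triple⇒pinchAt {suc (suc m)} (d<n , a>p , p>c) (inj₁ refl) =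
  pinch (stop nothing) (above p>c (stop nothing)) (<-trans p>c a>p) (inj₂ (here a>p))
triple⇒pinchAt {suc m} (d<n , a>p , p>c) (inj₂ refl) =
  pinch (above a>p (stop nothing)) (stop nothing) (<-trans p>c a>p) (inj₁ (here p>c))
triple⇒pinchAt {zero} (d<n , _) (inj₁ refl) = contradiction d<n (<-asym (n<1+n _))
triple⇒pinchAt {suc zero} (d<n , _) (inj₁ refl) = contradiction d<n (<-irrefl refl)
triple⇒pinchAt {zero} (d<n , _) (inj₂ refl) = contradiction d<n (<-irrefl refl)

data Reduction (k m : ℕ) (f : ℕ → ℕ) : Set where
  descend : Descent (m + k) f d → PinchAt k m (f ∘ τ d) → Reduction k m f
  triple  : Triple (m + k) f d → k ≡ suc d ⊎ k ≡ suc (suc d) → Reduction k m f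

pinchAt-reduce : ∀ {k m f} → PinchAt k m f → Reduction k m f
pinchAt-reduce {k} {m} {f} w with pinch-descent w
... | left s w′ with applyUpTo-swap⁻¹ k s
...   | e , e<k , lt , unique with m≤n⇒∃[o]m+o≡n e<k
...     | d , refl rewrite +-comm e d = descend
          (m≤n⇒m≤o+n m (s≤s (s≤s (m≤m+n d e))) ,
           subst₂ _<_ (cong f (m+n∸n≡m (suc d) e)) (cong f (m+n∸n≡m d e)) lt)
          (subst₂ (Pinch _<_) (unique (leftHalf-transposed {e} {d} {f}))
                  (sym (rightHalf-τ {m = m} {f = f} (s≤s (s≤s (m≤m+n d e))))) w′)
pinchAt-reduce {k} {m} {f} w | right s w′ with applyUpTo-swap⁻¹ m s
... | d , d<m , lt , unique = descend (+-monoˡ-< k d<m , lt)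
        (subst₂ (Pinch _<_) (sym (leftHalf-τ {f = f} (m≤n+m k d))) (unique (rightHalf-transposed {d} {m} {k} {f})) w′)
pinchAt-reduce {suc d} {suc m} {f} w | across refl refl lt w′ = descend (s≤s (m≤n+m (suc d) m) , lt)
        (subst₂ (Pinch _<_) (sym (leftHalf-cut {f = f})) (sym (rightHalf-cut {m = m} {f = f})) w′)
pinchAt-reduce {suc (suc d)} {suc m} w | tripleˡ refl refl p>c a>p = triple (s≤s (m≤n+m _ m) , a>p , p>c) (inj₂ refl)
pinchAt-reduce {suc d} {suc (suc m)} w | tripleʳ refl refl p>c a>p =
  triple (s≤s (s≤s (m≤n+m (suc d) m)) , a>p , p>c) (inj₁ refl)

-- Reduced words with different numbers of σ_k

-- Distant descents do not interfere, so undoing both in either order gives the same function, and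
-- one shortest word of it is prolonged in both ways.
commuting-words : ∀ {n f d e} → suc d < e → Perm n f → Descent n f d → Descent n f e →
  ∃ λ as → Shortest n f (as ∷ʳ suc d ∷ʳ suc e) × Shortest n f (as ∷ʳ suc e ∷ʳ suc d)
commuting-words {n} {f} {d} {e} d+1<e P Dd@(d<n , ltd) De@(e<n , lte)
  with shortest-exists _ (perm-τ d<n (perm-τ e<n P)) refl
... | as , S = as ,
  shortest-∷ʳ De (shortest-∷ʳ (d<n , ltd′) S) ,
  shortest-∷ʳ Dd (shortest-∷ʳ (e<n , lte′) (shortest-cong (λ x → cong f (τ-commute d+1<e x)) S))
  where
  ltd′ : f (τ e (suc d)) < f (τ e d)
  ltd′ = subst₂ _<_
    (cong f (sym (τ-fixed (<⇒≢ d+1<e) (<⇒≢ (m<n⇒m<1+n d+1<e)))))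
    (cong f (sym (τ-fixed (<⇒≢ (<-trans (n<1+n d) d+1<e)) (<⇒≢ (m<n⇒m<1+n (<-trans (n<1+n d) d+1<e))))))
    ltd
  lte′ : f (τ d (suc e)) < f (τ d e)
  lte′ = subst₂ _<_
    (cong f (sym (τ-fixed (>⇒≢ (<-trans (n<1+n d) (m<n⇒m<1+n d+1<e))) (>⇒≢ (m<n⇒m<1+n d+1<e)))))
    (cong f (sym (τ-fixed (>⇒≢ (<-trans (n<1+n d) d+1<e)) (>⇒≢ d+1<e))))
    lte

-- Undoing three descents sorts the triple, whichever pair comes first; by the braid relation the
-- results agree, so one word `as` has both prolongations.
braid-words : ∀ {n f d} → Perm n f → Triple n f d →
  ∃ λ as → Shortest n f (as ∷ʳ suc d ∷ʳ suc (suc d) ∷ʳ suc d) ×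
           Shortest n f (as ∷ʳ suc (suc d) ∷ʳ suc d ∷ʳ suc (suc d))
braid-words {n} {f} {d} P (b<n , a>p , p>c)
  with shortest-exists _ (perm-τ a<n (perm-τ b<n (perm-τ a<n P))) refl
  where
  a<n = <-trans (n<1+n _) b<n
... | as , S = as ,
  shortest-∷ʳ (a<n , a>p) (shortest-∷ʳ (b<n , lt₁) (shortest-∷ʳ (a<n , lt₂) S)) ,
  shortest-∷ʳ (b<n , p>c) (shortest-∷ʳ (a<n , lt₃) (shortest-∷ʳ (b<n , lt₄)
    (shortest-cong (λ x → cong f (τ-braid d x)) S)))
  where
  a<n = <-trans (n<1+n _) b<n
  top bottom : ℕ → ℕ
  top = τ d
  bottom = τ (suc d)
  top-2+d : top (suc (suc d)) ≡ suc (suc d)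
  top-2+d = τ-fixed (>⇒≢ (m<n⇒m<1+n (n<1+n d))) 1+n≢n
  bottom-d : bottom d ≡ d
  bottom-d = τ-fixed (<⇒≢ (n<1+n d)) (<⇒≢ (m<n⇒m<1+n (n<1+n d)))
  lt₁ : f (top (suc (suc d))) < f (top (suc d))
  lt₁ = subst₂ _<_ (cong f (sym top-2+d)) (cong f (sym (τ-upper d))) (<-trans p>c a>p)
  lt₂ : f (top (bottom (suc d))) < f (top (bottom d))
  lt₂ = subst₂ _<_ (cong f (sym (trans (cong top (τ-lower (suc d))) top-2+d)))
                   (cong f (sym (trans (cong top bottom-d) (τ-lower d)))) p>c
  lt₃ : f (bottom (suc d)) < f (bottom d)
  lt₃ = subst₂ _<_ (cong f (sym (τ-lower (suc d)))) (cong f (sym bottom-d)) (<-trans p>c a>p)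
  lt₄ : f (bottom (top (suc (suc d)))) < f (bottom (top (suc d)))
  lt₄ = subst₂ _<_ (cong f (sym (trans (cong bottom top-2+d) (τ-upper (suc d)))))
                   (cong f (sym (trans (cong bottom (τ-upper d)) bottom-d))) a>p

occ-∷ʳ-exchange : ∀ {k a b} as → occ k (as ∷ʳ a ∷ʳ b) ≡ occ k (as ∷ʳ b ∷ʳ a)
occ-∷ʳ-exchange {k} {a} {b} as
  rewrite occ-∷ʳ {k} {b} (as ∷ʳ a) | occ-∷ʳ {k} {a} as | occ-∷ʳ {k} {a} (as ∷ʳ b) | occ-∷ʳ {k} {b} as
  = trans (+-assoc (occ k as) _ _) (trans (cong (occ k as +_) (+-comm (occ k (a ∷ [])) _)) (sym (+-assoc (occ k as) _ _)))

occ-∷ʳ-same : ∀ {k} as → occ k (as ∷ʳ k) ≡ suc (occ k as)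
occ-∷ʳ-same {k} as = trans (occ-∷ʳ as) (trans (cong (occ k as +_) (occ-same {k})) (+-comm _ 1))

occ-∷ʳ-different : ∀ {k a} as → a ≢ k → occ k (as ∷ʳ a) ≡ occ k as
occ-∷ʳ-different {k} as a≢k = trans (occ-∷ʳ as) (trans (cong (occ k as +_) (occ-different a≢k)) (+-identityʳ _))

-- The link in Matsumoto's argument: two words with prescribed last letters that can be compared
-- directly.
record Joined (k m : ℕ) (f : ℕ → ℕ) (a b : ℕ) : Set where
  constructor joined
  field
    {fst snd} : List ℕ
    fst-shortest : Shortest (m + k) f (fst ∷ʳ a)
    snd-shortest : Shortest (m + k) f (snd ∷ʳ b)
    occ-fst-snd  : occ k (fst ∷ʳ a) ≡ occ k (snd ∷ʳ b) ⊎ PinchAt k m f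

joined-sym : ∀ {k m f a b} → Joined k m f a b → Joined k m f b a
joined-sym (joined S T eq) = joined T S (map₁ sym eq)

joined-< : ∀ {k m f d e} → d < e → Perm (m + k) f → Descent (m + k) f d → Descent (m + k) f e →
           Joined k m f (suc d) (suc e)
joined-< {k} {m} {f} {d} {e} d<e P Dd De with m≤n⇒m<n∨m≡n d<e
... | inj₁ d+1<e with commuting-words d+1<e P Dd De
...   | as , S , T = joined T S (inj₁ (occ-∷ʳ-exchange as))
joined-< {k} {m} {f} {d} _ P (_ , a>p) (b<n , p>c) | inj₂ refl with braid-words P (b<n , a>p , p>c)
... | as , S , T = joined S T occ≡
  where
  occ≡ : occ k (as ∷ʳ suc d ∷ʳ suc (suc d) ∷ʳ suc d) ≡ occ k (as ∷ʳ suc (suc d) ∷ʳ suc d ∷ʳ suc (suc d))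
         ⊎ PinchAt k m f
  occ≡ with k ≟ suc d | k ≟ suc (suc d)
  -- The braid move changes the number of `σ_k` only if `k` is one of its two letters; then the
  -- triple sits at the cut and is a pinch.
  ... | yes k≡a | _       = inj₂ (triple⇒pinchAt {f = f} (b<n , a>p , p>c) (inj₁ k≡a))
  ... | no _    | yes k≡b = inj₂ (triple⇒pinchAt {f = f} (b<n , a>p , p>c) (inj₂ k≡b))
  ... | no k≢a  | no k≢b  = inj₁ (trans
      (trans (occ-∷ʳ-different (as ∷ʳ suc d ∷ʳ suc (suc d)) (≢-sym k≢a)) (occ-∷ʳ-exchange as))
      (sym (occ-∷ʳ-different (as ∷ʳ suc (suc d) ∷ʳ suc d) (≢-sym k≢b))))

joined-≢ : ∀ {k m f d e} → d ≢ e → Perm (m + k) f → Descent (m + k) f d → Descent (m + k) f e →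
           Joined k m f (suc d) (suc e)
joined-≢ {d = d} {e} d≢e P Dd De with <-cmp d e
... | tri< d<e _ _ = joined-< d<e P Dd De
... | tri≈ _ d≡e _ = contradiction d≡e d≢e
... | tri> _ _ e<d = joined-sym (joined-< e<d P De Dd)

chain : ∀ {x y z : ℕ} {A : Set} → x ≡ y ⊎ A → y ≡ z ⊎ A → x ≡ z ⊎ A
chain (inj₂ a)    _           = inj₂ a
chain (inj₁ refl) y≡z = y≡z

-- Matsumoto's argument: words ending in different letters are compared through the longest
-- element of the dihedral parabolic subgroup generated by these two letters.
occ-unique : ∀ l {k m f u v} → inv (m + k) f ≡ l → Perm (m + k) f →
             Shortest (m + k) f u → Shortest (m + k) f v → occ k u ≡ occ k v ⊎ PinchAt k m f
-- Removing the common last letter allows induction on inversions; a pinch found for the shorter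
-- words lifts by `pinchAt-ascend`.
same-last : ∀ l {k m f u v d} → inv (m + k) f ≡ l → Perm (m + k) f →
            Shortest (m + k) f (u ∷ʳ suc d) → Shortest (m + k) f (v ∷ʳ suc d) →
            occ k (u ∷ʳ suc d) ≡ occ k (v ∷ʳ suc d) ⊎ PinchAt k m f

occ-unique l {u = u} {v} eq P S T with initLast u | initLast v
... | [] | [] = inj₁ refl
... | [] | v ∷ʳ′ _ = contradiction
      (trans (length≡inv S) (trans (sym (length≡inv T)) (length-∷ʳ v))) λ ()
... | u ∷ʳ′ _ | [] = contradiction
      (trans (length≡inv T) (trans (sym (length≡inv S)) (length-∷ʳ u))) λ ()
... | u ∷ʳ′ a | v ∷ʳ′ b with All.∷ʳ⁻ (valid (word S)) | All.∷ʳ⁻ (valid (word T))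
occ-unique l eq P S T | u ∷ʳ′ suc d | v ∷ʳ′ suc e | _ , s≤s z≤n , _ | _ , s≤s z≤n , _ with d ≟ e
... | yes refl = same-last l {u = u} {v} eq P S T
... | no d≢e with joined-≢ d≢e P (proj₁ (shortest-∷ʳ⁻ {as = u} P S)) (proj₁ (shortest-∷ʳ⁻ {as = v} P T))
...   | joined {u′} {v′} S′ T′ u′~v′ =
        -- The words from `u` and `u′` share their last letter, as do those from `v′` and `v`;
        -- `joined-≢` supplies the middle link.
        chain (same-last l {u = u} {u′} eq P S S′) (chain u′~v′ (same-last l {u = v′} {v} eq P T′ T))

same-last zero {u = u} eq P S T =
  contradiction (trans (sym eq) (trans (sym (length≡inv S)) (length-∷ʳ u))) λ ()
same-last (suc l) {k} {u = u} {v} {d} eq P S T with shortest-∷ʳ⁻ {as = u} P S | shortest-∷ʳ⁻ {as = v} P T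
... | D , S′ | _ , T′ with occ-unique l {u = u} {v} (suc-injective (trans (sym (inv-descent D)) eq)) (perm-τ (proj₁ D) P) S′ T′
...   | inj₂ w  = inj₂ (pinchAt-ascend P D w)
...   | inj₁ u~v = inj₁ (trans (occ-∷ʳ u) (trans (cong (_+ occ k (suc d ∷ [])) u~v) (sym (occ-∷ʳ v))))

-- Fact (2) strips descents until a decreasing triple at the cut appears, where the two braid words
-- differ in the number of `σ_k`; the stripped letters contribute equally to both words.
pinchAt⇒distinct : ∀ l {k m f} → inv (m + k) f ≡ l → Perm (m + k) f → PinchAt k m f →
  ∃₂ λ u v → Shortest (m + k) f u × Shortest (m + k) f v × occ k u < occ k v
pinchAt⇒distinct l eq P w with pinchAt-reduce w
pinchAt⇒distinct l eq P _ | triple T k≡ with braid-words P T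
-- Here `k` is the smaller braided letter: after `as` it occurs twice in `aba` and once in `bab`.
pinchAt⇒distinct l {k} eq P _ | triple {d} T (inj₁ refl) | as , aba , bab = _ , _ , bab , aba , gains
  where
  gains : occ k (as ∷ʳ suc k ∷ʳ k ∷ʳ suc k) < occ k (as ∷ʳ k ∷ʳ suc k ∷ʳ k)
  gains = ≤-reflexive (trans (cong suc (trans (occ-∷ʳ-different (as ∷ʳ suc k ∷ʳ k) 1+n≢n) (occ-∷ʳ-exchange as)))
                            (sym (occ-∷ʳ-same (as ∷ʳ k ∷ʳ suc k))))
pinchAt⇒distinct l {k} eq P _ | triple {d} T (inj₂ refl) | as , aba , bab = _ , _ , aba , bab , gains
  where
  gains : occ k (as ∷ʳ suc d ∷ʳ k ∷ʳ suc d) < occ k (as ∷ʳ k ∷ʳ suc d ∷ʳ k)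
  gains = ≤-reflexive (trans (cong suc (trans (occ-∷ʳ-different (as ∷ʳ suc d ∷ʳ k) (<⇒≢ (n<1+n (suc d)))) (occ-∷ʳ-exchange as)))
                            (sym (occ-∷ʳ-same (as ∷ʳ k ∷ʳ suc d))))
pinchAt⇒distinct zero eq P _ | descend D w = contradiction (trans (sym eq) (inv-descent D)) λ ()
pinchAt⇒distinct (suc l) {k} eq P _ | descend {d} D w
  with pinchAt⇒distinct l (suc-injective (trans (sym (inv-descent D)) eq)) (perm-τ (proj₁ D) P) w
... | u , v , S , T , u<v = u ∷ʳ suc d , v ∷ʳ suc d , shortest-∷ʳ D S , shortest-∷ʳ D T ,
      subst₂ _<_ (sym (occ-∷ʳ u)) (sym (occ-∷ʳ v)) (+-monoˡ-< (occ k (suc d ∷ [])) u<v)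

-- Pinches as positions

-- Counting along `ℕ` replaces filtering `allFin`, because initial segments can be split, shifted
-- and reversed.
count : (ℕ → Bool) → ℕ → ℕ
count β zero    = 0
count β (suc n) = if β 0 then suc (count (β ∘ suc) n) else count (β ∘ suc) n

count-cong : ∀ {β γ} n → (∀ {x} → x < n → β x ≡ γ x) → count β n ≡ count γ n
count-cong zero    eq = refl
count-cong {β} {γ} (suc n) eq rewrite eq {0} z<s with γ 0
... | true  = cong suc (count-cong n (eq ∘ s<s))
... | false = count-cong n (eq ∘ s<s)

count-+ : ∀ β s d → count β (s + d) ≡ count β s + count (β ∘ (s +_)) d
count-+ β zero    d = refl
count-+ β (suc s) d with β 0
... | true  = cong suc (count-+ (β ∘ suc) s d)
... | false = count-+ (β ∘ suc) s d

count-none : ∀ {β} n → (∀ {x} → x < n → β x ≡ false) → count β n ≡ 0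
count-none zero    none = refl
count-none (suc n) none rewrite none {0} z<s = count-none n (none ∘ s<s)

count-window : ∀ β s d e → (∀ {x} → x < s → β x ≡ false) → (∀ {x} → s + d ≤ x → β x ≡ false) →
               count β (s + (d + e)) ≡ count (β ∘ (s +_)) d
count-window β s d e before after
  rewrite count-+ β s (d + e) | count-none {β} s before | count-+ (β ∘ (s +_)) d e
        | count-none {β ∘ (s +_) ∘ (d +_)} e (λ {x} _ → after (+-monoʳ-≤ s (m≤m+n d x)))
  = +-identityʳ _

count-snoc : ∀ β d → count β (suc d) ≡ (if β d then suc (count β d) else count β d)
count-snoc β zero = refl
count-snoc β (suc d) rewrite count-snoc (β ∘ suc) d with β 0 | β (suc d)
... | true  | true  = refl
... | true  | false = refl
... | false | true  = refl
... | false | false = refl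

count-reverse : ∀ β d → count β d ≡ count (λ q → β (d ∸ suc q)) d
count-reverse β zero = refl
count-reverse β (suc d) rewrite count-snoc β d | count-reverse β d = refl

length-filter-tabulate : ∀ {A : Set} {P : A → Set} (P? : Decidable P) β {n} (h : Fin n → A) →
  (∀ q → does (P? (h q)) ≡ β (toℕ q)) → length (filter P? (tabulate h)) ≡ count β n
length-filter-tabulate P? β {zero}  h eq = refl
length-filter-tabulate P? β {suc n} h eq with does (P? (h Fin.zero)) | eq Fin.zero
... | true  | e rewrite sym e = cong suc (length-filter-tabulate P? (β ∘ suc) (h ∘ Fin.suc) (eq ∘ Fin.suc))
... | false | e rewrite sym e = length-filter-tabulate P? (β ∘ suc) (h ∘ Fin.suc) (eq ∘ Fin.suc)

module Depth {_≺_ : Rel ℕ 0ℓ} (isSTO : IsStrictTotalOrder _≡_ _≺_) (_≺?_ : Binary.Decidable _≺_) where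
  open IsStrictTotalOrder isSTO using (compare; asym) renaming (trans to ≺-trans)

  countBelow : (ℕ → ℕ) → ℕ → ℕ → ℕ
  countBelow g c = count (λ q → does (g q ≺? c))

  IncreasingBelow : (ℕ → ℕ) → ℕ → ℕ → Set
  IncreasingBelow g c d = ∀ {q r} → q < r → r < d → g q ≺ c → g r ≺ c → g q ≺ g r

  -- The bound `lo` serves the recursion, where a passed chain entry becomes the bound for the rest;
  -- the membership clause later places `w(p)` among the side entries.
  climb-at : ∀ {m lo c} g d → d < m → g d ≡ c → (∀ {q} → q < d → g q ≢ c) →
    Maybe.All (_≺ c) lo → (∀ {q} → q < d → g q ≺ c → Maybe.All (_≺ g q) lo) → IncreasingBelow g c d →
    ∃ λ bs → Climb _≺_ lo (applyUpTo g m) (countBelow g c d) bs c × (∀ {q} → q < d → c ≺ g q → g q ∈ bs)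
  climb-at {suc m} g zero d<m refl _ lo≺c _ _ = [] , stop lo≺c , λ ()
  climb-at {suc m} {lo} {c} g (suc d) (s<s d<m) gd≡c g≢c lo≺c lo≺g inc with g 0 ≺? c
  ... | yes g0≺c with climb-at {m} {just (g 0)} (g ∘ suc) d d<m gd≡c (g≢c ∘ s<s) (just g0≺c)
                        (λ q<d gq≺c → just (inc z<s (s<s q<d) g0≺c gq≺c))
                        (λ q<r r<d → inc (s<s q<r) (s<s r<d))
  ...   | bs , G , mem = bs , below (lo≺g z<s g0≺c) G , mem′
    where
    mem′ : ∀ {q} → q < suc d → c ≺ g q → g q ∈ bs
    mem′ {zero}  _         c≺g0 = contradiction g0≺c (asym c≺g0)
    mem′ {suc q} (s<s q<d) c≺gq = mem q<d c≺gq
  climb-at {suc m} {lo} {c} g (suc d) (s<s d<m) gd≡c g≢c lo≺c lo≺g inc | no g0⊀c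
    with compare (g 0) c | climb-at {m} {lo} (g ∘ suc) d d<m gd≡c (g≢c ∘ s<s) lo≺c (lo≺g ∘ s<s)
                             (λ q<r r<d → inc (s<s q<r) (s<s r<d))
  ... | tri< g0≺c _ _ | _ = contradiction g0≺c g0⊀c
  ... | tri≈ _ g0≡c _ | _ = contradiction g0≡c (g≢c z<s)
  ... | tri> _ _ c≺g0 | bs , G , mem = g 0 ∷ bs , above c≺g0 G , mem′
    where
    mem′ : ∀ {q} → q < suc d → c ≺ g q → g q ∈ g 0 ∷ bs
    mem′ {zero}  _         _    = here refl
    mem′ {suc q} (s<s q<d) c≺gq = there (mem q<d c≺gq)

  record AtDepth (lo : Maybe ℕ) (g : ℕ → ℕ) (m t : ℕ) (bs : List ℕ) (c : ℕ) : Set where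
    constructor atDepth
    field
      {depth}    : ℕ
      depth<m    : depth < m
      value      : g depth ≡ c
      countEq    : countBelow g c depth ≡ t
      increasing : IncreasingBelow g c depth
      exceedsLo  : ∀ {q} → q < depth → g q ≺ c → Maybe.All (_≺ g q) lo
      locate     : ∀ {x} → x ∈ bs → ∃ λ q → q < depth × g q ≡ x × c ≺ x

  -- The field `exceedsLo` drives the induction: at a `below` step the bound for the tail is the
  -- head, which yields the comparisons with the head that `increasing` demands.
  climb-depth : ∀ {lo t bs c} g m → Climb _≺_ lo (applyUpTo g m) t bs c → AtDepth lo g m t bs c
  climb-depth g (suc m) (stop _) = atDepth z<s refl refl (λ _ ()) (λ ()) (λ ())
  climb-depth {lo} {suc t} {bs} {c} g (suc m) (below lo≺g0 G) with climb-depth (g ∘ suc) m G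
  ... | atDepth {d} d<m value countEq inc exc locate =
        atDepth (s<s d<m) value count′ inc′ exc′ λ x∈ → let q , q<d , eq = locate x∈ in suc q , s<s q<d , eq
    where
    g0≺c = Half.climb-just isSTO G
    count′ : countBelow g c (suc d) ≡ suc t
    count′ rewrite dec-true (g 0 ≺? c) g0≺c = cong suc countEq
    inc′ : IncreasingBelow g c (suc d)
    inc′ {zero}  {suc r} _ (s<s r<d) _ gr≺c = Maybe.drop-just (exc r<d gr≺c)
    inc′ {suc q} {suc r} (s<s q<r) (s<s r<d) = inc q<r r<d
    exc′ : ∀ {q} → q < suc d → g q ≺ c → Maybe.All (_≺ g q) lo
    exc′ {zero}  _         _    = lo≺g0
    exc′ {suc q} (s<s q<d) gq≺c = Maybe.map (λ l≺g0 → ≺-trans l≺g0 (Maybe.drop-just (exc q<d gq≺c))) lo≺g0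
  climb-depth {lo} {t} {x ∷ bs} {c} g (suc m) (above c≺g0 G) with climb-depth (g ∘ suc) m G
  ... | atDepth {d} d<m value countEq inc exc locate = atDepth (s<s d<m) value count′ inc′ exc′ locate′
    where
    count′ : countBelow g c (suc d) ≡ t
    count′ rewrite dec-false (g 0 ≺? c) (asym c≺g0) = countEq
    inc′ : IncreasingBelow g c (suc d)
    inc′ {zero}  _ _ g0≺c = contradiction g0≺c (asym c≺g0)
    inc′ {suc q} {suc r} (s<s q<r) (s<s r<d) = inc q<r r<d
    exc′ : ∀ {q} → q < suc d → g q ≺ c → Maybe.All (_≺ g q) lo
    exc′ {zero}  _         g0≺c = contradiction g0≺c (asym c≺g0)
    exc′ {suc q} (s<s q<d) gq≺c = exc q<d gq≺c
    locate′ : ∀ {y} → y ∈ g 0 ∷ bs → ∃ λ q → q < suc d × g q ≡ y × c ≺ y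
    locate′ (here refl) = 0 , z<s , refl , c≺g0
    locate′ (there y∈)  = let q , q<d , eq = locate y∈ in suc q , s<s q<d , eq

module DepthR = Depth <-isStrictTotalOrder _<?_
module DepthL = Depth (isStrictTotalOrder <-isStrictTotalOrder) (flip _<?_)

-- The positions i = k ∸ suc depthˡ and j = depthʳ + k are given by their distances from the cut.
record Positions (k m : ℕ) (f : ℕ → ℕ) : Set where
  constructor positions
  field
    {depthˡ depthʳ p} : ℕ
    depthˡ<k    : depthˡ < k
    depthʳ<m    : depthʳ < m
    i<p         : k ∸ suc depthˡ < p
    p<j         : p < depthʳ + k
    fp<fi       : f p < f (k ∸ suc depthˡ)
    fj<fp       : f (depthʳ + k) < f p
    count≡      : DepthL.countBelow (λ q → f (k ∸ suc q)) (f (k ∸ suc depthˡ)) depthˡ ≡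
                  DepthR.countBelow (λ q → f (q + k)) (f (depthʳ + k)) depthʳ
    increasingˡ : DepthL.IncreasingBelow (λ q → f (k ∸ suc q)) (f (k ∸ suc depthˡ)) depthˡ
    increasingʳ : DepthR.IncreasingBelow (λ q → f (q + k)) (f (depthʳ + k)) depthʳ

unmirror : x < k → k ∸ suc (k ∸ suc x) ≡ x
unmirror x<k = sym (mirror x<k refl)

mirror-< : ∀ {q r k} → q < r → r < k → k ∸ suc r < k ∸ suc q
mirror-< q<r r<k = ∸-monoʳ-< (s<s q<r) r<k

mirror-<k : ∀ {q k} → q < k → k ∸ suc q < k
mirror-<k q<k = ∸-monoʳ-< z<s q<k

-- By injectivity the end values do not occur nearer to the cut, as `climb-at` demands. The position
-- `p` gives a side entry on the left if `p < k` and on the right otherwise.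
positions⇒pinchAt : ∀ {k m f} → Perm (m + k) f → Positions k m f → PinchAt k m f
positions⇒pinchAt {k} {m} {f} P (positions {dˡ} {dʳ} {p} dˡ<k dʳ<m i<p p<j fp<fi fj<fp count≡ incˡ incʳ)
  with DepthL.climb-at (λ q → f (k ∸ suc q)) dˡ dˡ<k refl
         (λ q<d eq → <⇒≢ (mirror-< q<d dˡ<k) (sym (injective P eq))) nothing (λ _ _ → nothing) incˡ
     | DepthR.climb-at (λ q → f (q + k)) dʳ dʳ<m refl
         (λ q<d eq → <⇒≢ (+-monoˡ-< k q<d) (injective P eq)) nothing (λ _ _ → nothing) incʳ
... | _ , Gˡ , memˡ | _ , Gʳ , memʳ =
  pinch (subst (λ t → Climb _ _ _ t _ _) count≡ Gˡ) Gʳ (<-trans fj<fp fp<fi) middle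
  where
  middle : Any (f (dʳ + k) <_) _ ⊎ Any (_< f (k ∸ suc dˡ)) _
  middle with p <? k
  ... | yes p<k = inj₁ (lose (memˡ depth< (subst (λ x → f x < f (k ∸ suc dˡ)) (sym (unmirror p<k)) fp<fi))
                             (subst (λ x → f (dʳ + k) < f x) (sym (unmirror p<k)) fj<fp))
    where
    depth< : k ∸ suc p < dˡ
    depth< = subst (k ∸ suc p <_) (unmirror dˡ<k) (mirror-< i<p p<k)
  ... | no p≮k with m≤n⇒∃[o]m+o≡n (≮⇒≥ p≮k)
  ...   | e , refl rewrite +-comm k e = inj₂ (lose (memʳ (+-cancelʳ-< k e dʳ p<j) fj<fp) fp<fi)

pinchAt⇒positions : ∀ {k m f} → PinchAt k m f → Positions k m f
pinchAt⇒positions {k} {m} {f} (pinch Gˡ Gʳ c<a mid)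
  with DepthL.climb-depth (λ q → f (k ∸ suc q)) k Gˡ | DepthR.climb-depth (λ q → f (q + k)) m Gʳ
... | DepthL.atDepth {dˡ} dˡ<k refl count≡ˡ incˡ _ locateˡ | DepthR.atDepth {dʳ} dʳ<m refl count≡ʳ incʳ _ locateʳ
  with mid
... | inj₁ any with find any
...   | _ , x∈ , c<x with locateˡ x∈
...     | q , q<d , refl , x<a = positions dˡ<k dʳ<m (mirror-< q<d dˡ<k)
            (<-≤-trans (mirror-<k (<-trans q<d dˡ<k)) (m≤n+m k dʳ)) x<a c<x
            (trans count≡ˡ (sym count≡ʳ)) incˡ incʳ
pinchAt⇒positions {k} {m} {f} (pinch Gˡ Gʳ c<a mid)
    | DepthL.atDepth {dˡ} dˡ<k refl count≡ˡ incˡ _ locateˡ | DepthR.atDepth {dʳ} dʳ<m refl count≡ʳ incʳ _ locateʳ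
    | inj₂ any with find any
...   | _ , x∈ , x<a with locateʳ x∈
...     | q , q<d , refl , c<x = positions dˡ<k dʳ<m (<-≤-trans (mirror-<k dˡ<k) (m≤n+m k q)) (+-monoˡ-< k q<d)
            x<a c<x (trans count≡ˡ (sym count≡ʳ)) incˡ incʳ

inLᵇ : ℕ → ℕ → (ℕ → ℕ) → ℕ → Bool
inLᵇ i k f x = does ((i <? x) ×-dec ((x <? k) ×-dec (f i <? f x)))

inRᵇ : ℕ → ℕ → (ℕ → ℕ) → ℕ → Bool
inRᵇ k j f x = does ((k ≤? x) ×-dec ((x <? j) ×-dec (f x <? f j)))

-- The positions of `L_w` lie in the window of length `d` after `i`, inside which only the
-- comparison of values is left to test.
count-inL : ∀ m i d f → count (inLᵇ i (suc i + d) f) (m + (suc i + d)) ≡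
                        DepthL.countBelow (λ q → f (suc i + d ∸ suc q)) (f i) d
count-inL m i d f = begin
  count β (m + (suc i + d))          ≡⟨ cong (count β) (trans (+-comm m _) (+-assoc (suc i) d m)) ⟩
  count β (suc i + (d + m))          ≡⟨ count-window β (suc i) d m
                                          (λ x≤i → dec-false (dec _) λ (i<x , _) → <⇒≱ i<x (s≤s⁻¹ x≤i))
                                          (λ k≤x → dec-false (dec _) λ (_ , x<k , _) → <⇒≱ x<k k≤x) ⟩
  count (β ∘ (suc i +_)) d           ≡⟨ count-cong d (λ {x} x<d → does-⇔
                                          (mk⇔ (proj₂ ∘ proj₂) (λ lt → s≤s (m≤m+n i x) , +-monoʳ-< (suc i) x<d , lt))
                                          (dec (suc i + x)) (f i <? f (suc i + x))) ⟩
  -- Positions from left to right become distances from the cut.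
  count (λ x → γ (suc i + x)) d      ≡⟨ count-reverse _ d ⟩
  count (λ q → γ (suc i + (d ∸ suc q))) d ≡⟨ count-cong d (λ q<d → cong γ (sym (+-∸-assoc (suc i) q<d))) ⟩
  count (λ q → γ (suc i + d ∸ suc q)) d ∎
  where
  open ≡-Reasoning
  β γ : ℕ → Bool
  β = inLᵇ i (suc i + d) f
  γ x = does (f i <? f x)
  dec : ∀ x → Dec (i < x × x < suc i + d × f i < f x)
  dec x = (i <? x) ×-dec ((x <? suc i + d) ×-dec (f i <? f x))

count-inR : ∀ m k d f → d < m → count (inRᵇ k (d + k) f) (m + k) ≡
                                DepthR.countBelow (λ q → f (q + k)) (f (d + k)) d
count-inR m k d f d<m with m≤n⇒∃[o]m+o≡n (<⇒≤ d<m)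
... | e , refl = begin
  count β (d + e + k)      ≡⟨ cong (count β) (+-comm (d + e) k) ⟩
  count β (k + (d + e))    ≡⟨ count-window β k d e
                                (λ x<k → dec-false (dec _) λ (k≤x , _) → <⇒≱ x<k k≤x)
                                (λ {x} j≤x → dec-false (dec _) λ (_ , x<j , _) → <⇒≱ x<j (subst (_≤ x) (+-comm k d) j≤x)) ⟩
  count (β ∘ (k +_)) d     ≡⟨ count-cong d (λ {x} x<d → trans (cong β (+-comm k x)) (does-⇔
                                (mk⇔ (proj₂ ∘ proj₂) (λ lt → m≤n+m k x , +-monoˡ-< k x<d , lt))
                                (dec (x + k)) (f (x + k) <? f (d + k)))) ⟩
  count (λ q → does (f (q + k) <? f (d + k))) d ∎
  where
  open ≡-Reasoning
  β : ℕ → Bool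
  β = inRᵇ k (d + k) f
  dec : ∀ x → Dec (k ≤ x × x < d + k × f x < f (d + k))
  dec x = (k ≤? x) ×-dec ((x <? d + k) ×-dec (f x <? f (d + k)))

-- From permutations of `Fin n` to functions on `ℕ`.

extend : ∀ {n} → Permutation′ n → ℕ → ℕ
extend {n} w x with x <? n
... | yes x<n = val w (fromℕ< x<n)
... | no _    = x

extend-toℕ : ∀ {n} (w : Permutation′ n) q → extend w (toℕ q) ≡ val w q
extend-toℕ {n} w q with toℕ q <? n
... | yes q<n = cong (val w) (fromℕ<-toℕ q q<n)
... | no q≮n  = contradiction (toℕ<n q) q≮n

extend-perm : ∀ {n} (w : Permutation′ n) → Perm n (extend w)
extend-perm {n} w = perm (λ {x} → bounded′ x) (λ {x} {y} → injective′ x y)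
  where
  bounded′ : ∀ x → x < n → extend w x < n
  bounded′ x x<n with x <? n
  ... | yes _  = toℕ<n _
  ... | no x≮n = contradiction x<n x≮n
  injective′ : ∀ x y → extend w x ≡ extend w y → x ≡ y
  injective′ x y eq with x <? n | y <? n
  ... | yes x<n | yes y<n = fromℕ<-injective x y x<n y<n (Injection.injective (↔⇒↣ w) (toℕ-injective eq))
  ... | yes _   | no y≮n  = contradiction (subst (_< n) eq (toℕ<n _)) y≮n
  ... | no x≮n  | yes _   = contradiction (subst (_< n) (sym eq) (toℕ<n _)) x≮n
  ... | no _    | no _    = eq

module _ {k m : ℕ} (w : Permutation′ (m + k)) where
  private
    ŵ : ℕ → ℕ
    ŵ = extend w

  cardL-count : ∀ i → cardL w k i ≡ count (inLᵇ (toℕ i) k ŵ) (m + k)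
  cardL-count i = length-filter-tabulate (InL? w k i) (inLᵇ (toℕ i) k ŵ) id does≡
    where
    does≡ : ∀ q → does (InL? w k i q) ≡ inLᵇ (toℕ i) k ŵ (toℕ q)
    does≡ q rewrite extend-toℕ w i | extend-toℕ w q = refl

  cardR-count : ∀ j → cardR w k j ≡ count (inRᵇ k (toℕ j) ŵ) (m + k)
  cardR-count j = length-filter-tabulate (InR? w k j) (inRᵇ k (toℕ j) ŵ) id does≡
    where
    does≡ : ∀ q → does (InR? w k j q) ≡ inRᵇ k (toℕ j) ŵ (toℕ q)
    does≡ q rewrite extend-toℕ w j | extend-toℕ w q = refl

  cardL-depth : ∀ i d → d < k → k ∸ suc d ≡ toℕ i →
                cardL w k i ≡ DepthL.countBelow (λ q → ŵ (k ∸ suc q)) (ŵ (k ∸ suc d)) d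
  cardL-depth i d d<k eq = trans (cardL-count i) (lemma (k ∸ suc d) (toℕ i) k d (sym eq) position)
    where
    position : suc (k ∸ suc d) + d ≡ k
    position = trans (sym (+-suc (k ∸ suc d) d)) (m∸n+n≡m d<k)
    -- Fresh variables for the positions and `k` let both equations be matched with `refl`.
    lemma : ∀ i i′ k d → i′ ≡ i → suc i + d ≡ k →
            count (inLᵇ i′ k ŵ) (m + k) ≡ DepthL.countBelow (λ q → ŵ (k ∸ suc q)) (ŵ i) d
    lemma i _ _ d refl refl = count-inL m i d ŵ

  cardR-depth : ∀ j d → d < m → d + k ≡ toℕ j →
                cardR w k j ≡ DepthR.countBelow (λ q → ŵ (q + k)) (ŵ (d + k)) d
  cardR-depth j d d<m eq = trans (cardR-count j)
    (trans (cong (λ x → count (inRᵇ k x ŵ) (m + k)) (sym eq)) (count-inR m k d ŵ d<m))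

  onFin : ∀ {x} → x < m + k → ∃ λ q → x ≡ toℕ q × ŵ x ≡ val w q
  onFin x<n = fromℕ< x<n , sym (toℕ-fromℕ< x<n) ,
    trans (cong ŵ (sym (toℕ-fromℕ< x<n))) (extend-toℕ w (fromℕ< x<n))

  witness⇒positions : Witness w k → Positions k m ŵ
  witness⇒positions (i , p , j , i<p , p<j , p↓i , j↓p , i<k , k≤j , card≡ , incL , incR)
    with m≤n⇒∃[o]m+o≡n k≤j
  ... | d , k+d≡j = positions dˡ<k d<m
        (subst (_< toℕ p) (sym i≡) i<p) (subst (toℕ p <_) (sym j≡) p<j)
        (subst₂ _<_ (sym (extend-toℕ w p)) (sym ŵi≡) p↓i)
        (subst₂ _<_ (sym ŵj≡) (sym (extend-toℕ w p)) j↓p)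
        (trans (sym (cardL-depth i dˡ dˡ<k i≡)) (trans card≡ (cardR-depth j d d<m j≡)))
        increasingˡ increasingʳ
    where
    dˡ = k ∸ suc (toℕ i)
    dˡ<k : dˡ < k
    dˡ<k = mirror-<k i<k
    i≡ : k ∸ suc dˡ ≡ toℕ i
    i≡ = unmirror i<k
    j≡ : d + k ≡ toℕ j
    j≡ = trans (+-comm d k) k+d≡j
    d<m : d < m
    d<m = +-cancelʳ-< k d m (subst (_< m + k) (sym j≡) (toℕ<n j))
    ŵi≡ : ŵ (k ∸ suc dˡ) ≡ val w i
    ŵi≡ = trans (cong ŵ i≡) (extend-toℕ w i)
    ŵj≡ : ŵ (d + k) ≡ val w j
    ŵj≡ = trans (cong ŵ j≡) (extend-toℕ w j)
    increasingˡ : DepthL.IncreasingBelow (λ q → ŵ (k ∸ suc q)) (ŵ (k ∸ suc dˡ)) dˡ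
    increasingˡ {q} {r} q<r r<d i↓q i↓r
      with onFin (<-≤-trans (mirror-<k (<-trans (<-trans q<r r<d) dˡ<k)) (m≤n+m k m))
         | onFin (<-≤-trans (mirror-<k (<-trans r<d dˡ<k)) (m≤n+m k m))
    -- A larger distance from the cut means further left, so `y` comes before `x`.
    ... | x , x≡ , ŵx≡ | y , y≡ , ŵy≡ = subst₂ _<_ (sym ŵy≡) (sym ŵx≡) (incL y x
          (after y≡ r<d , subst (_< k) y≡ (mirror-<k (<-trans r<d dˡ<k)) , subst₂ _<_ ŵi≡ ŵy≡ i↓r)
          (after x≡ (<-trans q<r r<d) , subst (_< k) x≡ (mirror-<k (<-trans (<-trans q<r r<d) dˡ<k)) , subst₂ _<_ ŵi≡ ŵx≡ i↓q)
          (subst₂ _<_ y≡ x≡ (mirror-< q<r (<-trans r<d dˡ<k))))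
      where
      after : ∀ {q x} → k ∸ suc q ≡ toℕ x → q < dˡ → toℕ i < toℕ x
      after x≡ q<d = subst₂ _<_ i≡ x≡ (mirror-< q<d dˡ<k)
    increasingʳ : DepthR.IncreasingBelow (λ q → ŵ (q + k)) (ŵ (d + k)) d
    increasingʳ {q} {r} q<r r<d q↓j r↓j
      with onFin (+-monoˡ-< k (<-trans (<-trans q<r r<d) d<m)) | onFin (+-monoˡ-< k (<-trans r<d d<m))
    ... | x , x≡ , ŵx≡ | y , y≡ , ŵy≡ = subst₂ _<_ (sym ŵx≡) (sym ŵy≡) (incR x y
          (subst (k ≤_) x≡ (m≤n+m k q) , subst₂ _<_ x≡ j≡ (+-monoˡ-< k (<-trans q<r r<d)) , subst₂ _<_ ŵx≡ ŵj≡ q↓j)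
          (subst (k ≤_) y≡ (m≤n+m k r) , subst₂ _<_ y≡ j≡ (+-monoˡ-< k r<d) , subst₂ _<_ ŵy≡ ŵj≡ r↓j)
          (subst₂ _<_ x≡ y≡ (+-monoˡ-< k q<r)))

  positions⇒witness : Positions k m ŵ → Witness w k
  positions⇒witness (positions {dˡ} {dʳ} {p} dˡ<k dʳ<m i<p p<j fp<fi fj<fp count≡ incˡ incʳ)
    with onFin (<-≤-trans (mirror-<k dˡ<k) (m≤n+m k m))
       | onFin (<-trans p<j (+-monoˡ-< k dʳ<m))
       | onFin (+-monoˡ-< k dʳ<m)
  ... | i , i≡ , ŵi≡ | p′ , p≡ , ŵp≡ | j , j≡ , ŵj≡ =
    i , p′ , j , subst₂ _<_ i≡ p≡ i<p , subst₂ _<_ p≡ j≡ p<j ,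
    subst₂ _<_ ŵp≡ ŵi≡ fp<fi , subst₂ _<_ ŵj≡ ŵp≡ fj<fp ,
    subst (_< k) i≡ (mirror-<k dˡ<k) , subst (k ≤_) j≡ (m≤n+m k dʳ) ,
    trans (cardL-depth i dˡ dˡ<k i≡) (trans count≡ (sym (cardR-depth j dʳ dʳ<m j≡))) , incL , incR
    where
    incL : LIncreasing w k i
    incL q r (i<q , q<k , i↓q) (i<r , r<k , i↓r) q<r =
      subst₂ _<_ (ŵ-mirror q q<k) (ŵ-mirror r r<k)
        (incˡ (mirror-< q<r r<k)
              (subst (k ∸ suc (toℕ q) <_) (unmirror dˡ<k) (mirror-< (subst (_< toℕ q) (sym i≡) i<q) q<k))
              (subst₂ _<_ (sym ŵi≡) (sym (ŵ-mirror r r<k)) i↓r)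
              (subst₂ _<_ (sym ŵi≡) (sym (ŵ-mirror q q<k)) i↓q))
      where
      ŵ-mirror : ∀ q → toℕ q < k → ŵ (k ∸ suc (k ∸ suc (toℕ q))) ≡ val w q
      ŵ-mirror q q<k = trans (cong ŵ (unmirror q<k)) (extend-toℕ w q)
    incR : RIncreasing w k j
    incR q r (k≤q , q<j , q↓j) (k≤r , r<j , r↓j) q<r =
      subst₂ _<_ (ŵ-shift q k≤q) (ŵ-shift r k≤r)
        (incʳ (∸-monoˡ-< q<r k≤q)
              (+-cancelʳ-< k _ _ (subst₂ _<_ (sym (m∸n+n≡m k≤r)) (sym j≡) r<j))
              (subst₂ _<_ (sym (ŵ-shift q k≤q)) (sym ŵj≡) q↓j)
              (subst₂ _<_ (sym (ŵ-shift r k≤r)) (sym ŵj≡) r↓j))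
      where
      ŵ-shift : ∀ q → k ≤ toℕ q → ŵ (toℕ q ∸ k + k) ≡ val w q
      ŵ-shift q k≤q = trans (cong ŵ (m∸n+n≡m k≤q)) (extend-toℕ w q)

  expresses⇒spells : ∀ {as} → Expresses w as → Spells (m + k) ŵ as
  expresses⇒spells {as} (valid , eval) = spells valid λ x<n → let q , x≡ , ŵx≡ = onFin x<n in
    trans (cong (evalWord as) x≡) (trans (eval q) (sym ŵx≡))

  spells⇒expresses : ∀ {as} → Spells (m + k) ŵ as → Expresses w as
  spells⇒expresses S = valid S , λ q → trans (eval S (toℕ<n q)) (extend-toℕ w q)

  -- A word with as many letters as inversions exists, so minimality bounds the length from above,
  -- and `inv≤length` bounds it from below.
  reduced⇒shortest : ∀ {as} → Reduced w as → Shortest (m + k) ŵ as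
  reduced⇒shortest {as} (E , minimal) with shortest-exists _ (extend-perm w) refl
  ... | bs , S = shortest (expresses⇒spells E) (≤-antisym
        (≤-trans (minimal bs (spells⇒expresses (word S))) (≤-reflexive (length≡inv S)))
        (inv≤length _ as refl (extend-perm w) (expresses⇒spells E)))

  shortest⇒reduced : ∀ {as} → Shortest (m + k) ŵ as → Reduced w as
  shortest⇒reduced S = spells⇒expresses (word S) , λ bs E →
    ≤-trans (≤-reflexive (length≡inv S)) (inv≤length _ bs refl (extend-perm w) (expresses⇒spells E))

  maxGtMin⇔witness : MaxGtMin w k ⇔ Witness w k
  maxGtMin⇔witness = mk⇔ to from
    where
    to : MaxGtMin w k → Witness w k
    to (u , v , U , V , u<v)
      with occ-unique _ refl (extend-perm w) (reduced⇒shortest U) (reduced⇒shortest V)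
    ... | inj₁ u≡v = contradiction u<v (<-irrefl u≡v)
    ... | inj₂ pinched = positions⇒witness (pinchAt⇒positions pinched)
    from : Witness w k → MaxGtMin w k
    from W with pinchAt⇒distinct _ refl (extend-perm w)
                  (positions⇒pinchAt (extend-perm w) (witness⇒positions W))
    ... | u , v , S , T , u<v = u , v , shortest⇒reduced S , shortest⇒reduced T , u<v

theorem5p1 : (n : ℕ) (w : Permutation′ n) (k : ℕ) → 1 ≤ k → k < n →
    MaxGtMin w k ⇔ Witness w k
-- The right half has length `m = n ∸ k`, which puts the size into the form `m + k`.
theorem5p1 n w k _ k<n with n ∸ k | m∸n+n≡m (<⇒≤ k<n)
... | m | refl = maxGtMin⇔witness w
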